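{- Let $q_n=\sum_{k=0}^n\binom nk^2k!$ for $n\ge0$ (a sequence of positive integers), and let $\{\Delta_n\}_{n\ge1}$ be generated by the third-order linear recurrence $$(n-1)(n-2)\Delta_{n+2}=(n-2)(n+1)(n^2+3n-2)\Delta_{n+1}-n^2(2n^3+n^2-7n-4)\Delta_n+(n-1)^2n^4\Delta_{n-1},\qquad n\ge3,$$ with the initial values $\Delta_1=-1$, $\Delta_2=-2$, $\Delta_3=-5$, $\Delta_4=8$. Then $\Delta_n$ is an integer for every $n\ge1$, and Euler's constant $\gamma$ has the continued fraction expansion $$\gamma=\mathop{\mathbf K}_{n=1}^{\infty}\left(\frac{a_n^*}{b_n^*}\right)=\cfrac{1}{2-\cfrac{1}{4-\cfrac{5}{16+\cfrac{36}{59-\cfrac{15740}{404+\cdots}}}}},$$ where $$a_1^*=1,\quad a_2^*=-1,\quad a_3^*=-5,\quad a_4^*=36,\quad a_5^*=-15740,$$ $$b_1^*=2,\quad b_2^*=4,\quad b_3^*=16,\quad b_4^*=59,\quad b_5^*=404,$$ and, for $n\ge6$, $$a_n^*=-\frac{(n-1)^2}{4}\Delta_n\Delta_{n-2},\qquad b_n^*=n^2\Delta_{n-1}+\frac{(n-1)(n-2)}{2}\,q_{n-2}.$$ Moreover, $\Delta_n$ is positive for every $n\ge4$, and $\Delta_{2n}$ is even for every $n\ge1$.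
   Context: $\gamma$ is Euler's constant. For sequences $(a_n)_{n\ge1},(b_n)_{n\ge1}$, the continued fraction $\mathop{\mathbf K}_{n=1}^\infty(a_n/b_n)=\cfrac{a_1}{b_1+\cfrac{a_2}{b_2+\cdots}}$ has $n$th numerator $A_n$ and $n$th denominator $B_n$ defined by $A_{ -1}=1,\ A_0=0,\ B_{ -1}=0,\ B_0=1$ and $A_n=b_nA_{n-1}+a_nA_{n-2}$, $B_n=b_nB_{n-1}+a_nB_{n-2}$ for $n\ge1$. The statement $\gamma=\mathop{\mathbf K}_{n=1}^\infty(a_n/b_n)$ means that $B_n\neq0$ for all sufficiently large $n$ and the convergents $A_n/B_n$ tend to $\gamma$ as $n\to\infty$. -}

module Defs where

open import Data.Integer.Base as ℤ using (ℤ; +_)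
import Data.Integer.Properties as ℤ
open import Data.Integer.Divisibility using (_∣_)
open import Data.List.Base using (map; sum; upTo)
open import Data.Nat.Base as ℕ using (ℕ; zero; suc; _!)
open import Data.Nat.Combinatorics using (_C_)
import Data.Nat.Properties as ℕ
open import Data.Nat.Tactic.RingSolver using (solve-∀)
open import Data.Product.Base using (∃; _×_; _,_; proj₁; proj₂)
open import Data.Rational.Base
open import Data.Rational.Properties
open import Data.Rational.Solver using (module +-*-Solver)
open import Data.Rational.Unnormalised.Base as ℚᵘ using (mkℚᵘ; *≡*; *≤*)
import Data.Rational.Unnormalised.Properties as ℚᵘ
open import Data.Sum.Base using (inj₁; inj₂)
open import Relation.Binary.PropositionalEquality

open +-*-Solver using (solve; _:=_; _:+_; _:*_; _:-_; :-_; con)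

fromℤ : ℤ → ℚ
fromℤ i = i / 1

fromℕ : ℕ → ℚ
fromℕ n = fromℤ (+ n)

IsInteger : ℚ → Set
IsInteger x = ∃ λ i → x ≡ fromℤ i

IsEvenInteger : ℚ → Set
IsEvenInteger x = ∃ λ i → x ≡ fromℤ i × + 2 ∣ i

fromℕ-+ : ∀ m n → fromℕ (m ℕ.+ n) ≡ fromℕ m + fromℕ n
fromℕ-+ m n = toℚᵘ-injective (begin
  toℚᵘ (fromℕ (m ℕ.+ n))            ≈⟨ toℚᵘ-fromℚᵘ (mkℚᵘ (+ (m ℕ.+ n)) 0) ⟩
  mkℚᵘ (+ (m ℕ.+ n)) 0              ≈⟨ *≡* (cong (ℤ._* + 1) (sym (cong₂ ℤ._+_ (ℤ.*-identityʳ (+ m)) (ℤ.*-identityʳ (+ n))))) ⟩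
  mkℚᵘ (+ m) 0 ℚᵘ.+ mkℚᵘ (+ n) 0    ≈⟨ ℚᵘ.+-cong (ℚᵘ.≃-sym (toℚᵘ-fromℚᵘ (mkℚᵘ (+ m) 0))) (ℚᵘ.≃-sym (toℚᵘ-fromℚᵘ (mkℚᵘ (+ n) 0))) ⟩
  toℚᵘ (fromℕ m) ℚᵘ.+ toℚᵘ (fromℕ n) ≈⟨ ℚᵘ.≃-sym (toℚᵘ-homo-+ (fromℕ m) (fromℕ n)) ⟩
  toℚᵘ (fromℕ m + fromℕ n)          ∎)
  where open ℚᵘ.≃-Reasoning

/-split : ∀ m n → + m / suc n ≡ fromℕ m * (+ 1 / suc n)
/-split m n = toℚᵘ-injective (begin
  toℚᵘ (+ m / suc n)                 ≈⟨ toℚᵘ-fromℚᵘ (mkℚᵘ (+ m) n) ⟩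
  mkℚᵘ (+ m) n                       ≈⟨ *≡* (cong₂ ℤ._*_ (sym (ℤ.*-identityʳ (+ m))) (cong (λ k → + suc k) (ℕ.+-identityʳ n))) ⟩
  mkℚᵘ (+ m) 0 ℚᵘ.* mkℚᵘ (+ 1) n     ≈⟨ ℚᵘ.*-cong (ℚᵘ.≃-sym (toℚᵘ-fromℚᵘ (mkℚᵘ (+ m) 0))) (ℚᵘ.≃-sym (toℚᵘ-fromℚᵘ (mkℚᵘ (+ 1) n))) ⟩
  toℚᵘ (fromℕ m) ℚᵘ.* toℚᵘ (+ 1 / suc n) ≈⟨ ℚᵘ.≃-sym (toℚᵘ-homo-* (fromℕ m) (+ 1 / suc n)) ⟩
  toℚᵘ (fromℕ m * (+ 1 / suc n))     ∎)
  where open ℚᵘ.≃-Reasoning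

n/n≡1 : ∀ n → + suc n / suc n ≡ 1ℚ
n/n≡1 n = fromℚᵘ-cong {mkℚᵘ (+ suc n) n} {mkℚᵘ (+ 1) 0}
  (*≡* (trans (ℤ.*-identityʳ (+ suc n)) (sym (ℤ.*-identityˡ (+ suc n)))))

n*1/n≡1 : ∀ n → fromℕ (suc n) * (+ 1 / suc n) ≡ 1ℚ
n*1/n≡1 n = trans (sym (/-split (suc n) n)) (n/n≡1 n)

n*1/[m*n]≡1/m : ∀ k a j → suc j ≡ suc a ℕ.* suc k →
                fromℕ (suc k) * (+ 1 / suc j) ≡ + 1 / suc a
n*1/[m*n]≡1/m k a j eq = trans (sym (/-split (suc k) j))
  (fromℚᵘ-cong {mkℚᵘ (+ suc k) j} {mkℚᵘ (+ 1) a}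
    (*≡* (cong +_ (trans (ℕ.*-comm (suc k) (suc a)) (trans (sym eq) (sym (ℕ.*-identityˡ (suc j))))))))

1/-pos : ∀ n → Positive (+ 1 / suc n)
1/-pos n = normalize-pos 1 (suc n)

1/-antimono : ∀ {m n} → m ℕ.≤ n → + 1 / suc n ≤ + 1 / suc m
1/-antimono {m} {n} m≤n = toℚᵘ-cancel-≤ (begin
  toℚᵘ (+ 1 / suc n) ≃⟨ toℚᵘ-fromℚᵘ (mkℚᵘ (+ 1) n) ⟩
  mkℚᵘ (+ 1) n       ≤⟨ *≤* (ℤ.+≤+ (ℕ.*-monoʳ-≤ 1 (ℕ.s≤s m≤n))) ⟩
  mkℚᵘ (+ 1) m       ≃⟨ ℚᵘ.≃-sym (toℚᵘ-fromℚᵘ (mkℚᵘ (+ 1) m)) ⟩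
  toℚᵘ (+ 1 / suc m) ∎)
  where open ℚᵘ.≤-Reasoning

archimedean : ∀ ε → 0ℚ < ε → ∃ λ N → ∀ n → N ℕ.≤ n → + 1 / suc n ≤ ε
archimedean ε 0<ε = go ε (positive 0<ε)
  where
  open ℚᵘ.≤-Reasoning
  go : ∀ ε → Positive ε → ∃ λ N → ∀ n → N ℕ.≤ n → + 1 / suc n ≤ ε
  go ε@(mkℚ (+ suc p) d _) _ = d , λ n d≤n → ≤-trans (1/-antimono d≤n) (toℚᵘ-cancel-≤ (begin
    toℚᵘ (+ 1 / suc d) ≃⟨ toℚᵘ-fromℚᵘ (mkℚᵘ (+ 1) d) ⟩
    mkℚᵘ (+ 1) d       ≤⟨ *≤* (ℤ.+≤+ (ℕ.*-monoˡ-≤ (suc d) {1} {suc p} (ℕ.s≤s ℕ.z≤n))) ⟩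
    toℚᵘ ε             ∎))

half : ℚ → ℚ
half ε = ½ * ε

half-pos : ∀ {ε} → 0ℚ < ε → 0ℚ < half ε
half-pos {ε} 0<ε = subst (_< ½ * ε) (*-zeroʳ ½) (*-monoʳ-<-pos ½ 0<ε)

half+half : ∀ ε → half ε + half ε ≡ ε
half+half = solve 1 (λ e → (con ½ :* e) :+ (con ½ :* e) := e) refl

∣-∣-near : ∀ {x y e} → x ≤ y + e → y ≤ x + e → ∣ x - y ∣ ≤ e
∣-∣-near {x} {y} {e} x≤ y≤ with ∣p∣≡p∨∣p∣≡-p (x - y)
... | inj₁ eq = subst₂ _≤_ (sym eq)
  (solve 2 (λ y e → (y :+ e) :- y := e) refl y e) (+-monoˡ-≤ (- y) x≤)
... | inj₂ eq = subst₂ _≤_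
  (trans (solve 2 (λ x y → y :- x := :- (x :- y)) refl x y) (sym eq))
  (solve 2 (λ x e → (x :+ e) :- x := e) refl x e) (+-monoˡ-≤ (- x) y≤)

p≤∣p∣ : ∀ p → p ≤ ∣ p ∣
p≤∣p∣ p with ≤-total 0ℚ p
... | inj₁ 0≤p = ≤-reflexive (sym (0≤p⇒∣p∣≡p 0≤p))
... | inj₂ p≤0 = ≤-trans p≤0 (0≤∣p∣ p)

∣-∣-sym : ∀ x y → ∣ x - y ∣ ≡ ∣ y - x ∣
∣-∣-sym x y = trans (cong ∣_∣ (solve 2 (λ x y → x :- y := :- (y :- x)) refl x y)) (∣-p∣≡∣p∣ (y - x))

∣-∣-triangle : ∀ x y z → ∣ x - z ∣ ≤ ∣ x - y ∣ + ∣ y - z ∣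
∣-∣-triangle x y z = subst (λ w → ∣ w ∣ ≤ ∣ x - y ∣ + ∣ y - z ∣)
  (solve 3 (λ x y z → (x :- y) :+ (y :- z) := x :- z) refl x y z) (∣p+q∣≤∣p∣+∣q∣ (x - y) (y - z))

∣∣-lipschitz : ∀ x y → ∣ ∣ x ∣ - ∣ y ∣ ∣ ≤ ∣ x - y ∣
∣∣-lipschitz x y = ∣-∣-near (step x y) (subst (λ w → ∣ y ∣ ≤ ∣ x ∣ + w) (∣-∣-sym y x) (step y x))
  where
  step : ∀ x y → ∣ x ∣ ≤ ∣ y ∣ + ∣ x - y ∣
  step x y = subst (λ w → ∣ w ∣ ≤ ∣ y ∣ + ∣ x - y ∣)
    (solve 2 (λ x y → y :+ (x :- y) := x) refl x y) (∣p+q∣≤∣p∣+∣q∣ y (x - y))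

+≤+⇒-≤- : ∀ p q r s → p + q ≤ r + s → p - s ≤ r - q
+≤+⇒-≤- p q r s h = subst₂ _≤_
  (solve 3 (λ p q s → (p :+ q) :+ ((:- q) :- s) := p :- s) refl p q s)
  (solve 3 (λ r q s → (r :+ s) :+ ((:- q) :- s) := r :- q) refl r q s)
  (+-monoˡ-≤ (- q - s) h)

+-swapʳ : ∀ p q r → p + q + r ≡ p + r + q
+-swapʳ = solve 3 (λ p q r → p :+ q :+ r := p :+ r :+ q) refl

+--swapʳ : ∀ p q r → p + q - r ≡ p - r + q
+--swapʳ = solve 3 (λ p q r → p :+ q :- r := p :- r :+ q) refl

p+q-p≡q : ∀ p q → p + q - p ≡ q
p+q-p≡q = solve 2 (λ p q → p :+ q :- p := q) refl

-- A real number is a Cauchy sequence of rationals together with a modulus;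
-- two of them are the same real when each is ≤ᴿ the other.

IsCauchy : (ℕ → ℚ) → Set
IsCauchy x = ∀ ε → 0ℚ < ε → ∃ λ N → ∀ m n → N ℕ.≤ m → N ℕ.≤ n → ∣ x m - x n ∣ ≤ ε

record ℝ : Set where
  constructor mkℝ
  field
    approx : ℕ → ℚ
    cauchy : IsCauchy approx

open ℝ public

infix  4 _≤ᴿ_
infixl 6 _-ᴿ_

fromℚ : ℚ → ℝ
fromℚ q = mkℝ (λ _ → q) λ ε 0<ε → 0 , λ _ _ _ _ →
  subst (_≤ ε) (sym (cong ∣_∣ (+-inverseʳ q))) (<⇒≤ 0<ε)

_-ᴿ_ : ℝ → ℝ → ℝ
x -ᴿ y = mkℝ (λ n → approx x n - approx y n) c
  where
  c : IsCauchy (λ n → approx x n - approx y n)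
  c ε 0<ε with cauchy x (half ε) (half-pos 0<ε) | cauchy y (half ε) (half-pos 0<ε)
  ... | M , hx | N , hy = M ℕ.+ N , λ m n ≤m ≤n →
    let x₁ = approx x m
        x₂ = approx x n
        y₁ = approx y m
        y₂ = approx y n
        M≤ = ℕ.m+n≤o⇒m≤o M
        N≤ = ℕ.m+n≤o⇒n≤o M
    in begin
      ∣ (x₁ - y₁) - (x₂ - y₂) ∣ ≡⟨ cong ∣_∣ (solve 4 (λ x₁ x₂ y₁ y₂ → (x₁ :- y₁) :- (x₂ :- y₂) := (x₁ :- x₂) :- (y₁ :- y₂)) refl x₁ x₂ y₁ y₂) ⟩
      ∣ (x₁ - x₂) - (y₁ - y₂) ∣ ≤⟨ ∣p-q∣≤∣p∣+∣q∣ (x₁ - x₂) (y₁ - y₂) ⟩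
      ∣ x₁ - x₂ ∣ + ∣ y₁ - y₂ ∣ ≤⟨ +-mono-≤ (hx m n (M≤ ≤m) (M≤ ≤n)) (hy m n (N≤ ≤m) (N≤ ≤n)) ⟩
      half ε + half ε           ≡⟨ half+half ε ⟩
      ε                         ∎
    where open ≤-Reasoning

∣_∣ᴿ : ℝ → ℝ
∣ x ∣ᴿ = mkℝ (λ n → ∣ approx x n ∣) λ ε 0<ε →
  let N , h = cauchy x ε 0<ε in
  N , λ m n ≤m ≤n → ≤-trans (∣∣-lipschitz (approx x m) (approx x n)) (h m n ≤m ≤n)

_≤ᴿ_ : ℝ → ℝ → Set
x ≤ᴿ y = ∀ δ → 0ℚ < δ → ∃ λ N → ∀ n → N ℕ.≤ n → approx x n ≤ approx y n + δ

infix 4 _⟶_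

_⟶_ : (ℕ → ℝ) → ℝ → Set
x ⟶ l = ∀ ε → 0ℚ < ε → ∃ λ N → ∀ n → N ℕ.≤ n → ∣ x n -ᴿ l ∣ᴿ ≤ᴿ fromℚ ε

IsCauchyᴿ : (ℕ → ℝ) → Set
IsCauchyᴿ x = ∀ ε → 0ℚ < ε → ∃ λ N → ∀ m n → N ℕ.≤ m → N ℕ.≤ n → ∣ x m -ᴿ x n ∣ᴿ ≤ᴿ fromℚ ε

-- Completeness: the limit is the diagonal sequence whose n-th term
-- approximates x n to within 1/(n+1).
module Limit (x : ℕ → ℝ) (xc : IsCauchyᴿ x) where

  modulus : ℕ → ℕ
  modulus n = proj₁ (cauchy (x n) (+ 1 / suc n) (positive⁻¹ _ {{1/-pos n}}))

  diagonal : ℕ → ℚ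
  diagonal n = approx (x n) (modulus n)

  diagonal-near : ∀ n k → modulus n ℕ.≤ k → ∣ approx (x n) k - diagonal n ∣ ≤ + 1 / suc n
  diagonal-near n k ≤k =
    proj₂ (cauchy (x n) (+ 1 / suc n) (positive⁻¹ _ {{1/-pos n}})) k (modulus n) ≤k ℕ.≤-refl

  diagonal-cauchy : IsCauchy diagonal
  diagonal-cauchy ε 0<ε = A ℕ.+ B , λ m n ≤m ≤n →
    let L , h = proj₂ (xc η 0<η) m n (ℕ.m+n≤o⇒n≤o A ≤m) (ℕ.m+n≤o⇒n≤o A ≤n) η 0<η
        k     = modulus m ℕ.+ modulus n ℕ.+ L
        m≤k   = ℕ.≤-trans (ℕ.m≤m+n (modulus m) (modulus n)) (ℕ.m≤m+n _ L)
        n≤k   = ℕ.≤-trans (ℕ.m≤n+m (modulus n) (modulus m)) (ℕ.m≤m+n _ L)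
        u     = approx (x m) k
        v     = approx (x n) k
    in begin
      ∣ diagonal m - diagonal n ∣
        ≤⟨ ∣-∣-triangle (diagonal m) u (diagonal n) ⟩
      ∣ diagonal m - u ∣ + ∣ u - diagonal n ∣
        ≤⟨ +-monoʳ-≤ ∣ diagonal m - u ∣ (∣-∣-triangle u v (diagonal n)) ⟩
      ∣ diagonal m - u ∣ + (∣ u - v ∣ + ∣ v - diagonal n ∣)
        ≤⟨ +-mono-≤ (subst (_≤ η) (∣-∣-sym u (diagonal m))
                      (≤-trans (diagonal-near m k m≤k) (a m (ℕ.m+n≤o⇒m≤o A ≤m))))
             (+-mono-≤ (h k (ℕ.m≤n+m L _))
                       (≤-trans (diagonal-near n k n≤k) (a n (ℕ.m+n≤o⇒m≤o A ≤n)))) ⟩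
      η + ((η + η) + η)
        ≡⟨ solve 1 (λ e → let h = con ½ :* (con ½ :* e) in h :+ ((h :+ h) :+ h) := e) refl ε ⟩
      ε ∎
    where
    open ≤-Reasoning
    η = half (half ε)
    0<η = half-pos (half-pos 0<ε)
    A = proj₁ (archimedean η 0<η)
    a = proj₂ (archimedean η 0<η)
    B = proj₁ (xc η 0<η)

  lim : ℝ
  lim = mkℝ diagonal diagonal-cauchy

  lim-⟶ : x ⟶ lim
  lim-⟶ ε 0<ε = A ℕ.+ B , λ n ≤n δ 0<δ → modulus n ℕ.+ B , λ k ≤k → begin
      ∣ approx (x n) k - diagonal k ∣
        ≤⟨ ∣-∣-triangle (approx (x n) k) (diagonal n) (diagonal k) ⟩
      ∣ approx (x n) k - diagonal n ∣ + ∣ diagonal n - diagonal k ∣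
        ≤⟨ +-mono-≤ (≤-trans (diagonal-near n k (ℕ.m+n≤o⇒m≤o (modulus n) ≤k)) (a n (ℕ.m+n≤o⇒m≤o A ≤n)))
                    (b n k (ℕ.m+n≤o⇒n≤o A ≤n) (ℕ.m+n≤o⇒n≤o (modulus n) ≤k)) ⟩
      half ε + half ε
        ≡⟨ half+half ε ⟩
      ε
        ≡⟨ +-identityʳ ε ⟨
      ε + 0ℚ
        ≤⟨ +-monoʳ-≤ ε (<⇒≤ 0<δ) ⟩
      ε + δ ∎
    where
    open ≤-Reasoning
    A = proj₁ (archimedean (half ε) (half-pos 0<ε))
    a = proj₂ (archimedean (half ε) (half-pos 0<ε))
    B = proj₁ (diagonal-cauchy (half ε) (half-pos 0<ε))
    b = proj₂ (diagonal-cauchy (half ε) (half-pos 0<ε))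

open Limit public using (lim; lim-⟶)

∑< : ℕ → (ℕ → ℚ) → ℚ
∑< zero    f = 0ℚ
∑< (suc n) f = ∑< n f + f n

H : ℕ → ℚ
H n = ∑< n λ i → + 1 / suc i

H-split : ∀ a b → H (a ℕ.+ b) ≡ H a + ∑< b λ i → + 1 / suc (a ℕ.+ i)
H-split a zero    = trans (cong H (ℕ.+-identityʳ a)) (sym (+-identityʳ (H a)))
H-split a (suc b) = begin
  H (a ℕ.+ suc b)                        ≡⟨ cong H (ℕ.+-suc a b) ⟩
  H (a ℕ.+ b) + + 1 / suc (a ℕ.+ b)      ≡⟨ cong (_+ + 1 / suc (a ℕ.+ b)) (H-split a b) ⟩
  H a + S + + 1 / suc (a ℕ.+ b)          ≡⟨ +-assoc (H a) S (+ 1 / suc (a ℕ.+ b)) ⟩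
  H a + (S + + 1 / suc (a ℕ.+ b))        ∎
  where
  open ≡-Reasoning
  S = ∑< b λ i → + 1 / suc (a ℕ.+ i)

∑<-const : ∀ n r → ∑< n (λ _ → r) ≡ fromℕ n * r
∑<-const zero    r = sym (*-zeroˡ r)
∑<-const (suc n) r = begin
  ∑< n (λ _ → r) + r     ≡⟨ cong (_+ r) (∑<-const n r) ⟩
  fromℕ n * r + r        ≡⟨ solve 2 (λ n r → n :* r :+ r := (con 1ℚ :+ n) :* r) refl (fromℕ n) r ⟩
  (1ℚ + fromℕ n) * r     ≡⟨ cong (_* r) (fromℕ-+ 1 n) ⟨
  fromℕ (suc n) * r      ∎
  where open ≡-Reasoning

∑<-mono : ∀ n {f g : ℕ → ℚ} → (∀ i → i ℕ.< n → f i ≤ g i) → ∑< n f ≤ ∑< n g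
∑<-mono zero    _ = ≤-refl
∑<-mono (suc n) h = +-mono-≤ (∑<-mono n λ i i<n → h i (ℕ.m<n⇒m<1+n i<n)) (h n ℕ.≤-refl)

∑<-cong : ∀ n {f g : ℕ → ℚ} → (∀ i → f i ≡ g i) → ∑< n f ≡ ∑< n g
∑<-cong zero    _ = refl
∑<-cong (suc n) h = cong₂ _+_ (∑<-cong n h) (h n)

-- With M = k+1, the terms 1/j for aM < j ≤ (a+1)M are all ≥ 1/((a+1)M), so
-- their sum is ≥ 1/(a+1).
block-lower : ∀ k a → H (a ℕ.* suc k) + + 1 / suc a ≤ H (suc a ℕ.* suc k)
block-lower k a = begin
  H c + + 1 / suc a                                ≡⟨ cong (λ z → H c + z) (n*1/[m*n]≡1/m k a (k ℕ.+ c) refl) ⟨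
  H c + fromℕ (suc k) * (+ 1 / suc (k ℕ.+ c))      ≡⟨ cong (λ z → H c + z) (∑<-const (suc k) (+ 1 / suc (k ℕ.+ c))) ⟨
  H c + ∑< (suc k) (λ _ → + 1 / suc (k ℕ.+ c))     ≤⟨ +-monoʳ-≤ (H c) (∑<-mono (suc k) λ i i≤k → 1/-antimono (ub i i≤k)) ⟩
  H c + ∑< (suc k) (λ i → + 1 / suc (c ℕ.+ i))     ≡⟨ H-split c (suc k) ⟨
  H (c ℕ.+ suc k)                                  ≡⟨ cong H (ℕ.+-comm c (suc k)) ⟩
  H (suc a ℕ.* suc k)                              ∎
  where
  open ≤-Reasoning
  c = a ℕ.* suc k
  ub : ∀ i → i ℕ.< suc k → c ℕ.+ i ℕ.≤ k ℕ.+ c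
  ub i (ℕ.s≤s i≤k) = subst (c ℕ.+ i ℕ.≤_) (ℕ.+-comm c k) (ℕ.+-monoʳ-≤ c i≤k)

-- The terms 1/j for (a+1)M < j ≤ (a+2)M are all ≤ 1/((a+1)M), so their sum
-- is ≤ 1/(a+1).
block-upper : ∀ k a → H (suc (suc a) ℕ.* suc k) ≤ H (suc a ℕ.* suc k) + + 1 / suc a
block-upper k a = begin
  H (suc (suc a) ℕ.* suc k)                        ≡⟨ cong H (ℕ.+-comm (suc k) c) ⟩
  H (c ℕ.+ suc k)                                  ≡⟨ H-split c (suc k) ⟩
  H c + ∑< (suc k) (λ i → + 1 / suc (c ℕ.+ i))     ≤⟨ +-monoʳ-≤ (H c) (∑<-mono (suc k) λ i _ → 1/-antimono (lb i)) ⟩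
  H c + ∑< (suc k) (λ _ → + 1 / c)                 ≡⟨ cong (λ z → H c + z) (∑<-const (suc k) (+ 1 / c)) ⟩
  H c + fromℕ (suc k) * (+ 1 / c)                  ≡⟨ cong (λ z → H c + z) (n*1/[m*n]≡1/m k a (k ℕ.+ a ℕ.* suc k) refl) ⟩
  H c + + 1 / suc a                                ∎
  where
  open ≤-Reasoning
  c = suc a ℕ.* suc k
  lb : ∀ i → k ℕ.+ a ℕ.* suc k ℕ.≤ c ℕ.+ i
  lb i = ℕ.≤-trans (ℕ.n≤1+n _) (ℕ.m≤m+n c i)

-- H(b) − H(a) ≤ H(bM) − H(aM) for a ≤ b, where b = a + d and M = k + 1.
refine-lower : ∀ k a d → H (a ℕ.+ d) + H (a ℕ.* suc k) ≤ H ((a ℕ.+ d) ℕ.* suc k) + H a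
refine-lower k a zero = subst (λ b → H b + H (a ℕ.* suc k) ≤ H (b ℕ.* suc k) + H a) (sym (ℕ.+-identityʳ a))
  (≤-reflexive (+-comm (H a) (H (a ℕ.* suc k))))
refine-lower k a (suc d) = subst (λ b → H b + s ≤ H (b ℕ.* suc k) + H a) (sym (ℕ.+-suc a d)) (begin
  H b + r + s          ≡⟨ +-swapʳ (H b) r s ⟩
  H b + s + r          ≤⟨ +-monoˡ-≤ r (refine-lower k a d) ⟩
  t + H a + r          ≡⟨ +-swapʳ t (H a) r ⟩
  t + r + H a          ≤⟨ +-monoˡ-≤ (H a) (block-lower k b) ⟩
  H (suc b ℕ.* suc k) + H a ∎)
  where
  open ≤-Reasoning
  b = a ℕ.+ d
  r = + 1 / suc b
  s = H (a ℕ.* suc k)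
  t = H (b ℕ.* suc k)

-- H(bM) − H(aM) ≤ H(b−1) − H(a−1) for 0 < a ≤ b.
refine-upper′ : ∀ k a d → H (suc (a ℕ.+ d) ℕ.* suc k) + H a ≤ H (a ℕ.+ d) + H (suc a ℕ.* suc k)
refine-upper′ k a zero = subst (λ b → H (suc b ℕ.* suc k) + H a ≤ H b + H (suc a ℕ.* suc k)) (sym (ℕ.+-identityʳ a))
  (≤-reflexive (+-comm (H (suc a ℕ.* suc k)) (H a)))
refine-upper′ k a (suc d) = subst (λ b → H (suc b ℕ.* suc k) + H a ≤ H b + s) (sym (ℕ.+-suc a d)) (begin
  H (suc (suc b) ℕ.* suc k) + H a ≤⟨ +-monoˡ-≤ (H a) (block-upper k b) ⟩
  t + r + H a                     ≡⟨ +-swapʳ t r (H a) ⟩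
  t + H a + r                     ≤⟨ +-monoˡ-≤ r (refine-upper′ k a d) ⟩
  H b + s + r                     ≡⟨ +-swapʳ (H b) s r ⟩
  H b + r + s                     ∎)
  where
  open ≤-Reasoning
  b = a ℕ.+ d
  r = + 1 / suc b
  s = H (suc a ℕ.* suc k)
  t = H (suc b ℕ.* suc k)

-- H(bM) − H(aM) ≤ H(b) − H(a) + 1/a for 0 < a ≤ b.
refine-upper : ∀ k a d → H (suc (a ℕ.+ d) ℕ.* suc k) + H (suc a) ≤
                         H (suc (a ℕ.+ d)) + H (suc a ℕ.* suc k) + + 1 / suc a
refine-upper k a d = begin
  t + (H a + r)              ≡⟨ +-assoc t (H a) r ⟨
  (t + H a) + r              ≤⟨ +-monoˡ-≤ r (refine-upper′ k a d) ⟩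
  (H b + s) + r              ≡⟨ cong (_+ r) (cong (_+ s) (+-identityʳ (H b))) ⟨
  ((H b + 0ℚ) + s) + r       ≤⟨ +-monoˡ-≤ r (+-monoˡ-≤ s (+-monoʳ-≤ (H b) (<⇒≤ (positive⁻¹ _ {{1/-pos b}})))) ⟩
  (H (suc b) + s) + r        ∎
  where
  open ≤-Reasoning
  b = a ℕ.+ d
  r = + 1 / suc a
  s = H (suc a ℕ.* suc k)
  t = H (suc b ℕ.* suc k)

-- log n = ∫₁ⁿ dt/t, the limit of the right-endpoint Riemann sums with m+1
-- steps per unit length, whose nodes are 1 + (i+1)/(m+1).

node : ℕ → ℕ → ℚ
node m i = 1ℚ + + suc i / suc m

node-pos : ∀ m i → Positive (node m i)
node-pos m i = pos+pos⇒pos 1ℚ (+ suc i / suc m) {{normalize-pos (suc i) (suc m)}}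

reciprocal : (x : ℚ) → Positive x → ℚ
reciprocal x x>0 = (1/ x) {{pos⇒nonZero x {{x>0}}}}

logSum : (n : ℕ) .{{_ : ℕ.NonZero n}} → ℕ → ℚ
logSum n m = ∑< (ℕ.pred n ℕ.* suc m) λ i →
  (+ 1 / suc m) * reciprocal (node m i) (node-pos m i)

logSum-term : ∀ m i → (+ 1 / suc m) * reciprocal (node m i) (node-pos m i) ≡ + 1 / suc (suc m ℕ.+ i)
logSum-term m i = begin
  a * r                       ≡⟨ *-identityˡ (a * r) ⟨
  1ℚ * (a * r)                ≡⟨ cong (_* (a * r)) (trans (sym (n*1/n≡1 (suc m ℕ.+ i))) (cong (λ z → fromℕ z * c) (sym (ℕ.+-suc (suc m) i)))) ⟩
  (N * c) * (a * r)           ≡⟨ solve 4 (λ N c a r → (N :* c) :* (a :* r) := c :* ((N :* a) :* r)) refl N c a r ⟩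
  c * ((N * a) * r)           ≡⟨ cong (λ z → c * (z * r)) node≡ ⟨
  c * (node m i * r)          ≡⟨ cong (c *_) (*-inverseʳ (node m i) {{pos⇒nonZero (node m i) {{node-pos m i}}}}) ⟩
  c * 1ℚ                      ≡⟨ *-identityʳ c ⟩
  c                           ∎
  where
  open ≡-Reasoning
  a = + 1 / suc m
  r = reciprocal (node m i) (node-pos m i)
  c = + 1 / suc (suc m ℕ.+ i)
  N = fromℕ (suc m ℕ.+ suc i)
  node≡ : node m i ≡ N * a
  node≡ = begin
    1ℚ + + suc i / suc m                    ≡⟨ cong₂ _+_ (sym (n*1/n≡1 m)) (/-split (suc i) m) ⟩
    fromℕ (suc m) * a + fromℕ (suc i) * a   ≡⟨ *-distribʳ-+ a (fromℕ (suc m)) (fromℕ (suc i)) ⟨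
    (fromℕ (suc m) + fromℕ (suc i)) * a     ≡⟨ cong (_* a) (fromℕ-+ (suc m) (suc i)) ⟨
    N * a                                   ∎

-- logSum n (M−1) = H(nM) − H(M)
logSum-H : ∀ n m → H (suc m) + logSum (suc n) m ≡ H (suc n ℕ.* suc m)
logSum-H n m = trans (cong (λ z → H (suc m) + z) (∑<-cong (n ℕ.* suc m) (logSum-term m)))
                     (sym (H-split (suc m) (n ℕ.* suc m)))

logSum-difference : ∀ n m → H (suc n ℕ.* suc m) - H (suc m) ≡ logSum (suc n) m
logSum-difference n m = trans (cong (_- H (suc m)) (sym (logSum-H n m)))
                              (p+q-p≡q (H (suc m)) (logSum (suc n) m))

-- Compare the sums with M = m+1 and M′ = m′+1 steps through the common
-- refinement with MM′ steps.
logSum-compare : ∀ n m m′ → logSum (suc n) m ≤ logSum (suc n) m′ + + 1 / suc m′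
logSum-compare n m m′ = begin
  logSum (suc n) m       ≡⟨ logSum-difference n m ⟨
  H nM - H M             ≤⟨ +≤+⇒-≤- (H nM) (H (M ℕ.* M′)) (H (nM ℕ.* M′)) (H M) (refine-lower m′ M (n ℕ.* M)) ⟩
  H (nM ℕ.* M′) - H (M ℕ.* M′)
                         ≡⟨ cong₂ (λ x y → H x - H y) (*-swapʳ (suc n) M M′) (ℕ.*-comm M M′) ⟩
  H (nM′ ℕ.* M) - H (M′ ℕ.* M)
                         ≤⟨ +≤+⇒-≤- (H (nM′ ℕ.* M)) (H M′) (H nM′ + r) (H (M′ ℕ.* M)) upper ⟩
  H nM′ + r - H M′       ≡⟨ +--swapʳ (H nM′) r (H M′) ⟩
  H nM′ - H M′ + r       ≡⟨ cong (_+ r) (logSum-difference n m′) ⟩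
  logSum (suc n) m′ + r  ∎
  where
  open ≤-Reasoning
  M   = suc m
  M′  = suc m′
  nM  = suc n ℕ.* M
  nM′ = suc n ℕ.* M′
  r   = + 1 / M′
  *-swapʳ : ∀ x y z → x ℕ.* y ℕ.* z ≡ x ℕ.* z ℕ.* y
  *-swapʳ = solve-∀
  upper : H (nM′ ℕ.* M) + H M′ ≤ H nM′ + r + H (M′ ℕ.* M)
  upper = ≤-trans (refine-upper m m′ (n ℕ.* M′))
                  (≤-reflexive (+-swapʳ (H nM′) (H (M′ ℕ.* M)) r))

logSum-cauchy : ∀ n .{{_ : ℕ.NonZero n}} → IsCauchy (logSum n)
logSum-cauchy (suc n) ε 0<ε = proj₁ small , λ i j ≤i ≤j → ∣-∣-near
  (≤-trans (logSum-compare n i j) (+-monoʳ-≤ (logSum (suc n) j) (proj₂ small j ≤j)))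
  (≤-trans (logSum-compare n j i) (+-monoʳ-≤ (logSum (suc n) i) (proj₂ small i ≤i)))
  where small = archimedean ε 0<ε

log : (n : ℕ) .{{_ : ℕ.NonZero n}} → ℝ
log n = mkℝ (logSum n) (logSum-cauchy n)

-- The sequence H n − log n, n ≥ 1, indexed from 0.
H-log : ℕ → ℝ
H-log n = fromℚ (H (suc n)) -ᴿ log (suc n)

fromℚ-ᴿ-approx : ∀ x l k {h s} → h + approx l k ≡ s → approx (fromℚ x -ᴿ l) k ≡ x - s + h
fromℚ-ᴿ-approx x l k {h} refl =
  solve 3 (λ x l h → x :- l := x :- (h :+ l) :+ h) refl x (approx l k) h

H-log-approx : ∀ n k → approx (H-log n) k ≡ H (suc n) - H (suc n ℕ.* suc k) + H (suc k)
H-log-approx n k = fromℚ-ᴿ-approx (H (suc n)) (log (suc n)) k (logSum-H n k)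

H-log-decreasing : ∀ n d k → approx (H-log (n ℕ.+ d)) k ≤ approx (H-log n) k
H-log-decreasing n d k = subst₂ _≤_ (sym (H-log-approx (n ℕ.+ d) k)) (sym (H-log-approx n k))
  (+-monoˡ-≤ (H (suc k)) (+≤+⇒-≤- (H x) (H (y ℕ.* suc k)) (H y) (H (x ℕ.* suc k))
    (≤-trans (refine-lower k y d) (≤-reflexive (+-comm (H (x ℕ.* suc k)) (H y))))))
  where
  x = suc (n ℕ.+ d)
  y = suc n

H-log-slow : ∀ n d k → approx (H-log n) k ≤ approx (H-log (n ℕ.+ d)) k + + 1 / suc n
H-log-slow n d k = begin
  approx (H-log n) k                        ≡⟨ H-log-approx n k ⟩
  H y - s + h                               ≤⟨ +-monoˡ-≤ h (+≤+⇒-≤- (H y) t (H x + r) s (begin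
    H y + t                                   ≡⟨ +-comm (H y) t ⟩
    t + H y                                   ≤⟨ refine-upper k n d ⟩
    H x + s + r                               ≡⟨ +-swapʳ (H x) s r ⟩
    H x + r + s                               ∎)) ⟩
  H x + r - t + h                           ≡⟨ cong (_+ h) (+--swapʳ (H x) r t) ⟩
  H x - t + r + h                           ≡⟨ +-swapʳ (H x - t) r h ⟩
  H x - t + h + r                           ≡⟨ cong (_+ r) (H-log-approx (n ℕ.+ d) k) ⟨
  approx (H-log (n ℕ.+ d)) k + r            ∎
  where
  open ≤-Reasoning
  x = suc (n ℕ.+ d)
  y = suc n
  s = H (y ℕ.* suc k)
  t = H (x ℕ.* suc k)
  h = H (suc k)
  r = + 1 / suc n

H-log-cauchy : IsCauchyᴿ H-log
H-log-cauchy ε 0<ε = N , λ m n N≤m N≤n δ 0<δ → 0 , λ k _ →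
  ≤-trans (∣-∣-near (compare m n N≤m N≤n k) (compare n m N≤n N≤m k))
          (subst (_≤ ε + δ) (+-identityʳ ε) (+-monoʳ-≤ ε (<⇒≤ 0<δ)))
  where
  open ≤-Reasoning
  N = proj₁ (archimedean ε 0<ε)
  h = proj₂ (archimedean ε 0<ε)
  compare : ∀ m n → N ℕ.≤ m → N ℕ.≤ n → ∀ k → approx (H-log m) k ≤ approx (H-log n) k + ε
  compare m n N≤m N≤n k = begin
    approx (H-log m) k
      ≡⟨ cong (λ z → approx (H-log z) k) (ℕ.m+[n∸m]≡n N≤m) ⟨
    approx (H-log (N ℕ.+ (m ℕ.∸ N))) k
      ≤⟨ H-log-decreasing N (m ℕ.∸ N) k ⟩
    approx (H-log N) k
      ≤⟨ H-log-slow N (n ℕ.∸ N) k ⟩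
    approx (H-log (N ℕ.+ (n ℕ.∸ N))) k + + 1 / suc N
      ≡⟨ cong (λ z → approx (H-log z) k + + 1 / suc N) (ℕ.m+[n∸m]≡n N≤n) ⟩
    approx (H-log n) k + + 1 / suc N
      ≤⟨ +-monoʳ-≤ (approx (H-log n) k) (h N ℕ.≤-refl) ⟩
    approx (H-log n) k + ε ∎

γ : ℝ
γ = lim H-log H-log-cauchy

H-log-⟶-γ : H-log ⟶ γ
H-log-⟶-γ = lim-⟶ H-log H-log-cauchy

-- Solution of X n = b n · X (n−1) + a n · X (n−2) for n ≥ 1, shifted by one:
-- recur a b x₋₁ x₀ n = X (n−1). The values a 0 and b 0 are not used.
recur : (a b : ℕ → ℚ) → ℚ → ℚ → ℕ → ℚ
recur a b x₋₁ x₀ zero          = x₋₁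
recur a b x₋₁ x₀ (suc zero)    = x₀
recur a b x₋₁ x₀ (suc (suc n)) =
  b (suc n) * recur a b x₋₁ x₀ (suc n) + a (suc n) * recur a b x₋₁ x₀ n

numerator denominator : (a b : ℕ → ℚ) → ℕ → ℚ
numerator   a b n = recur a b 1ℚ 0ℚ (suc n)
denominator a b n = recur a b 0ℚ 1ℚ (suc n)

record _≡K[_/_] (l : ℝ) (a b : ℕ → ℚ) : Set where
  field
    start        : ℕ
    nonvanishing : ∀ n → start ℕ.≤ n → denominator a b n ≢ 0ℚ

  convergent : ∀ n → start ℕ.≤ n → ℚ
  convergent n ≤n = (numerator a b n ÷ denominator a b n) {{≢-nonZero (nonvanishing n ≤n)}}

  field
    converges : (λ k → fromℚ (convergent (start ℕ.+ k) (ℕ.m≤m+n start k))) ⟶ l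

q : ℕ → ℕ
q n = sum (map (λ k → (n C k) ℕ.^ 2 ℕ.* k !) (upTo (suc n)))

q-pos : ∀ n → 0 ℕ.< q n
q-pos n = ℕ.s≤s ℕ.z≤n

-- The last clause of a* and of b* is meant for n ≥ 6; it also matches n = 0,
-- where the value is not used by the continued fraction.

a* : (ℕ → ℚ) → ℕ → ℚ
a* Δ 1 = fromℤ (+ 1)
a* Δ 2 = fromℤ (ℤ.- + 1)
a* Δ 3 = fromℤ (ℤ.- + 5)
a* Δ 4 = fromℤ (+ 36)
a* Δ 5 = fromℤ (ℤ.- + 15740)
a* Δ n = - ((+ ((n ℕ.∸ 1) ℕ.^ 2) / 4) * Δ n * Δ (n ℕ.∸ 2))

b* : (ℕ → ℚ) → ℕ → ℚ
b* Δ 1 = fromℤ (+ 2)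
b* Δ 2 = fromℤ (+ 4)
b* Δ 3 = fromℤ (+ 16)
b* Δ 4 = fromℤ (+ 59)
b* Δ 5 = fromℤ (+ 404)
b* Δ n = fromℕ (n ℕ.^ 2) * Δ (n ℕ.∸ 1) + (+ ((n ℕ.∸ 1) ℕ.* (n ℕ.∸ 2)) / 2) * fromℕ (q (n ℕ.∸ 2))

{-# OPTIONS --safe #-}

-- Let q n and p n be n!² times the sums over j + i = n of 1 / (j!² i!) and
-- of (2 H j − H i) / (j!² i!). Then q n = 2n q (n−1) − (n−1)² q (n−2), and p
-- satisfies the same relation up to a term −(n−2)/n. It follows that
-- n (p (n−1) q n − p n q (n−1)) satisfies
--   Δ n = n (n−1) Δ (n−1) + (n−2) q (n−1),
-- from which the third-order recurrence arises by eliminating q. This relation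
-- makes the integrality, sign and parity of Δ evident, and shows that p n and
-- q n are, up to a common factor, the numerators and denominators of the
-- continued fraction.
--
-- The quotient p n / q n is an average of 2 H j − H i, which is close to
-- γ + log (a² / b) with a = j + 1 and b = i + 1. The ratio of consecutive
-- weights bounds the averages of a² / b and b / a² by 1 + o(1), so p n / q n
-- tends to γ because 1 − 1/x ≤ log x ≤ x − 1.

module Submission where

open import Data.Integer.Base using (+_) renaming (-_ to -ℤ_)
open import Data.Nat.Base using (ℕ; _^_) renaming (_≤_ to _≤ℕ_; _+_ to _+ℕ_; _*_ to _*ℕ_; _∸_ to _∸ℕ_)
open import Data.Product.Base using (_×_)
open import Data.Rational.Base using (ℚ; 0ℚ; _+_; _-_; _*_; _<_)
open import Relation.Binary.PropositionalEquality using (_≡_)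
open import Defs

open import Data.List.Base using (map; applyUpTo)
open import Data.Nat.Base as ℕ using (zero; suc; _!)
open import Data.Nat.Combinatorics using (_C_; nCk≡n!/k![n-k]!; k![n∸k]!∣n!)
import Data.Nat.Divisibility as ℕ
open import Data.Nat.DivMod using (m/n*n≡m)
open import Data.Nat.ListAction using (sum)
import Data.Nat.Properties as ℕ
open import Data.Product.Base using (_,_; proj₁; proj₂)
open import Data.Rational.Base using (1ℚ; ½; _÷_; 1/_; -_; ∣_∣; _/_; _≤_; Positive; NonZero; positive; nonNegative; ≢-nonZero)
open import Data.Rational.Properties
open import Data.Sum.Base using (inj₁; inj₂)
open import Relation.Binary.PropositionalEquality using (_≢_; refl; sym; trans; cong; cong₂; subst; subst₂; module ≡-Reasoning)
open import Relation.Nullary.Decidable using (dec⇒maybe)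
open import Tactic.RingSolver using (solve-∀)
open import Tactic.RingSolver.Core.AlmostCommutativeRing using (AlmostCommutativeRing; fromCommutativeRing)

-- The sums are read as coefficients of products of power series. With θ = x d/dx, the series A of
-- the 1/j!² satisfies θ²A = xA and B = exp satisfies θB = xB, so the Leibniz rule yields a
-- recurrence for AB. The numbers 2 H j - H i - γ are minus the logarithmic derivatives at ε = 0 of
-- 1 / (Γ(j+1+ε)² Γ(i+1-ε)). Thus p is tied to a shift of the weights along the antidiagonal, which
-- explains both why it nearly satisfies the recurrence of q and why γ appears.
--
-- A continued fraction needs one homogeneous recurrence for numerators and denominators, while that
-- of p has a source. The source is a multiple of Δ, which is itself linear in consecutive values of
-- p, so it can be absorbed into the coefficients.
--
-- In the limit, single values of 2 H j - H i may be far from γ; only their average is controlled.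
-- Logarithms are limits of Riemann sums, so the estimates are made at a fixed mesh 1 / (k + 1),
-- with an error of that size.

ℚ-ring : AlmostCommutativeRing _ _
ℚ-ring = fromCommutativeRing +-*-commutativeRing λ x → dec⇒maybe (0ℚ ≟ x)

fromℕ-suc : ∀ n → fromℕ (suc n) ≡ 1ℚ + fromℕ n
fromℕ-suc = fromℕ-+ 1

fromℕ-* : ∀ m n → fromℕ (m ℕ.* n) ≡ fromℕ m * fromℕ n
fromℕ-* zero    n = sym (*-zeroˡ (fromℕ n))
fromℕ-* (suc m) n = begin
  fromℕ (n ℕ.+ m ℕ.* n)             ≡⟨ fromℕ-+ n (m ℕ.* n) ⟩
  fromℕ n + fromℕ (m ℕ.* n)         ≡⟨ cong (λ z → fromℕ n + z) (fromℕ-* m n) ⟩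
  fromℕ n + fromℕ m * fromℕ n       ≡⟨ distrib (fromℕ m) (fromℕ n) ⟩
  (1ℚ + fromℕ m) * fromℕ n          ≡⟨ cong (_* fromℕ n) (fromℕ-suc m) ⟨
  fromℕ (suc m) * fromℕ n           ∎
  where
  open ≡-Reasoning
  distrib : ∀ x y → y + x * y ≡ (1ℚ + x) * y
  distrib = solve-∀ ℚ-ring

-- Sums over an antidiagonal

∑↗ : ℕ → (ℕ → ℕ → ℚ) → ℚ
∑↗ zero    f = f 0 0
∑↗ (suc n) f = f 0 (suc n) + ∑↗ n (λ j i → f (suc j) i)

∑↗-peelʳ : ∀ n f → ∑↗ (suc n) f ≡ ∑↗ n (λ j i → f j (suc i)) + f (suc n) 0
∑↗-peelʳ zero    f = refl
∑↗-peelʳ (suc n) f = trans (cong (λ z → f 0 (suc (suc n)) + z) (∑↗-peelʳ n (λ j i → f (suc j) i)))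
  (sym (+-assoc (f 0 (suc (suc n))) _ _))

∑↗-cong : ∀ n {f g} → (∀ j i → j ℕ.+ i ≡ n → f j i ≡ g j i) → ∑↗ n f ≡ ∑↗ n g
∑↗-cong zero    h = h 0 0 refl
∑↗-cong (suc n) h = cong₂ _+_ (h 0 (suc n) refl) (∑↗-cong n λ j i eq → h (suc j) i (cong suc eq))

∑↗-mono : ∀ n {f g} → (∀ j i → j ℕ.+ i ≡ n → f j i ≤ g j i) → ∑↗ n f ≤ ∑↗ n g
∑↗-mono zero    h = h 0 0 refl
∑↗-mono (suc n) h = +-mono-≤ (h 0 (suc n) refl) (∑↗-mono n λ j i eq → h (suc j) i (cong suc eq))

∑↗-+ : ∀ n f g → ∑↗ n (λ j i → f j i + g j i) ≡ ∑↗ n f + ∑↗ n g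
∑↗-+ zero    f g = refl
∑↗-+ (suc n) f g = trans (cong (λ z → f 0 (suc n) + g 0 (suc n) + z) (∑↗-+ n _ _))
  (interchange (f 0 (suc n)) (g 0 (suc n)) _ _)
  where
  interchange : ∀ a b c d → a + b + (c + d) ≡ a + c + (b + d)
  interchange = solve-∀ ℚ-ring

∑↗-*ˡ : ∀ n c f → ∑↗ n (λ j i → c * f j i) ≡ c * ∑↗ n f
∑↗-*ˡ zero    c f = refl
∑↗-*ˡ (suc n) c f = trans (cong (λ z → c * f 0 (suc n) + z) (∑↗-*ˡ n c _))
  (sym (*-distribˡ-+ c (f 0 (suc n)) _))

-- Cauchy products of coefficient sequences and the operator x d/dx

conv : (ℕ → ℚ) → (ℕ → ℚ) → ℕ → ℚ
conv f g n = ∑↗ n λ j i → f j * g i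

θ : (ℕ → ℚ) → ℕ → ℚ
θ f n = fromℕ n * f n

conv-congˡ : ∀ n {f f′} g → (∀ j → f j ≡ f′ j) → conv f g n ≡ conv f′ g n
conv-congˡ n g h = ∑↗-cong n λ j i _ → cong (_* g i) (h j)

conv-congʳ : ∀ n f {g g′} → (∀ i → g i ≡ g′ i) → conv f g n ≡ conv f g′ n
conv-congʳ n f h = ∑↗-cong n λ j i _ → cong (f j *_) (h i)

conv-+ˡ : ∀ n f f′ g → conv (λ j → f j + f′ j) g n ≡ conv f g n + conv f′ g n
conv-+ˡ n f f′ g = trans (∑↗-cong n λ j i _ → *-distribʳ-+ (g i) (f j) (f′ j)) (∑↗-+ n _ _)

conv-+ʳ : ∀ n f g g′ → conv f (λ i → g i + g′ i) n ≡ conv f g n + conv f g′ n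
conv-+ʳ n f g g′ = trans (∑↗-cong n λ j i _ → *-distribˡ-+ (f j) (g i) (g′ i)) (∑↗-+ n _ _)

conv-sucʳ : ∀ n f g → conv f g (suc n) ≡ conv f (λ i → g (suc i)) n + f (suc n) * g 0
conv-sucʳ n f g = ∑↗-peelʳ n λ j i → f j * g i

-- `θ f` has no constant coefficient, so it is divisible by x and the index can be shifted.
conv-θˡ-suc : ∀ n f g → conv (θ f) g (suc n) ≡ conv (λ j → θ f (suc j)) g n
conv-θˡ-suc n f g = zeros (f 0) (g (suc n)) _
  where
  zeros : ∀ x y z → 0ℚ * x * y + z ≡ z
  zeros = solve-∀ ℚ-ring

conv-θʳ-suc : ∀ n f g → conv f (θ g) (suc n) ≡ conv f (λ i → θ g (suc i)) n
conv-θʳ-suc n f g = trans (conv-sucʳ n f (θ g)) (zeros (f (suc n)) (g 0) _)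
  where
  zeros : ∀ x y z → z + x * (0ℚ * y) ≡ z
  zeros = solve-∀ ℚ-ring

-- θ is a derivation, because n = j + i on the antidiagonal.
conv-leibniz : ∀ n f g → fromℕ n * conv f g n ≡ conv (θ f) g n + conv f (θ g) n
conv-leibniz n f g = begin
  fromℕ n * conv f g n                                   ≡⟨ ∑↗-*ˡ n (fromℕ n) _ ⟨
  ∑↗ n (λ j i → fromℕ n * (f j * g i))                   ≡⟨ ∑↗-cong n (λ { j i refl → split j i }) ⟩
  ∑↗ n (λ j i → θ f j * g i + f j * θ g i)               ≡⟨ ∑↗-+ n _ _ ⟩
  conv (θ f) g n + conv f (θ g) n                        ∎
  where
  open ≡-Reasoning
  expand : ∀ x y u v → (x + y) * (u * v) ≡ x * u * v + u * (y * v)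
  expand = solve-∀ ℚ-ring
  split : ∀ j i → fromℕ (j ℕ.+ i) * (f j * g i) ≡ θ f j * g i + f j * θ g i
  split j i = trans (cong (_* (f j * g i)) (fromℕ-+ j i)) (expand (fromℕ j) (fromℕ i) (f j) (g i))

conv-leibniz² : ∀ n f g → fromℕ n * fromℕ n * conv f g n
                ≡ conv (θ (θ f)) g n + (conv (θ f) (θ g) n + conv (θ f) (θ g) n) + conv f (θ (θ g)) n
conv-leibniz² n f g = begin
  fromℕ n * fromℕ n * conv f g n                         ≡⟨ *-assoc (fromℕ n) (fromℕ n) _ ⟩
  fromℕ n * (fromℕ n * conv f g n)                       ≡⟨ cong (fromℕ n *_) (conv-leibniz n f g) ⟩
  fromℕ n * (conv (θ f) g n + conv f (θ g) n)            ≡⟨ *-distribˡ-+ (fromℕ n) _ _ ⟩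
  fromℕ n * conv (θ f) g n + fromℕ n * conv f (θ g) n    ≡⟨ cong₂ _+_ (conv-leibniz n (θ f) g) (conv-leibniz n f (θ g)) ⟩
  conv (θ (θ f)) g n + conv (θ f) (θ g) n + (conv (θ f) (θ g) n + conv f (θ (θ g)) n)
                                                         ≡⟨ regroup (conv (θ (θ f)) g n) (conv (θ f) (θ g) n) _ ⟩
  conv (θ (θ f)) g n + (conv (θ f) (θ g) n + conv (θ f) (θ g) n) + conv f (θ (θ g)) n ∎
  where
  open ≡-Reasoning
  regroup : ∀ a b c → a + b + (b + c) ≡ a + (b + b) + c
  regroup = solve-∀ ℚ-ring

-- The weights 1/i! and 1/j!², and their products with harmonic numbers

β : ℕ → ℚ
β zero    = 1ℚ
β (suc i) = β i * (+ 1 / suc i)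

α : ℕ → ℚ
α j = β j * β j

βH αH : ℕ → ℚ
βH i = β i * H i
αH j = α j * H j

n*[x/n] : ∀ n x → fromℕ (suc n) * (x * (+ 1 / suc n)) ≡ x
n*[x/n] n x = trans (swap (fromℕ (suc n)) x (+ 1 / suc n))
  (trans (cong (x *_) (n*1/n≡1 n)) (*-identityʳ x))
  where
  swap : ∀ n x r → n * (x * r) ≡ x * (n * r)
  swap = solve-∀ ℚ-ring

-- The equation θB = xB of the exponential series, read off coefficientwise; `θθα-suc` is θ²A = xA
-- in the same way.
θβ-suc : ∀ i → θ β (suc i) ≡ β i
θβ-suc i = n*[x/n] i (β i)

θθβ-suc : ∀ i → θ (θ β) (suc i) ≡ θ β i + β i
θθβ-suc i = trans (cong₂ _*_ (fromℕ-suc i) (θβ-suc i)) (distrib (fromℕ i) (β i))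
  where
  distrib : ∀ x y → (1ℚ + x) * y ≡ x * y + y
  distrib = solve-∀ ℚ-ring

θα-suc : ∀ j → θ α (suc j) ≡ α j * (+ 1 / suc j)
θα-suc j = trans (regroup (fromℕ (suc j)) (β j) (+ 1 / suc j)) (n*[x/n] j _)
  where
  regroup : ∀ n b r → n * (b * r * (b * r)) ≡ n * (b * b * r * r)
  regroup = solve-∀ ℚ-ring

θθα-suc : ∀ j → θ (θ α) (suc j) ≡ α j
θθα-suc j = trans (cong (fromℕ (suc j) *_) (θα-suc j)) (n*[x/n] j (α j))

θβH-suc : ∀ i → θ βH (suc i) ≡ βH i + β (suc i)
θβH-suc i = trans (regroup (fromℕ (suc i)) (β (suc i)) (H i) (+ 1 / suc i))
  (cong₂ (λ x y → x * H i + y) (θβ-suc i) (n*[x/n] i (β (suc i))))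
  where
  regroup : ∀ n b h r → n * (b * (h + r)) ≡ n * b * h + n * (b * r)
  regroup = solve-∀ ℚ-ring

-- The equation of `α` again, with a source produced by the increment 1/(j+1) of `H`.
θθαH-suc : ∀ j → θ (θ αH) (suc j) ≡ αH j + θ α (suc j)
θθαH-suc j = trans (regroup (fromℕ (suc j)) (α (suc j)) (H j) (+ 1 / suc j))
  (cong₂ (λ x y → x * H j + fromℕ (suc j) * y) (θθα-suc j) (n*[x/n] j (α (suc j))))
  where
  regroup : ∀ n a h r → n * (n * (a * (h + r))) ≡ n * (n * a) * h + n * (n * (a * r))
  regroup = solve-∀ ℚ-ring

conv-θβ : ∀ n f → conv f (θ β) (suc n) ≡ conv f β n
conv-θβ n f = trans (conv-θʳ-suc n f β) (conv-congʳ n f θβ-suc)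

-- Shifting `β` loses the summand at i = 0. These lost summands are the origin of the error term of
-- `p`.
conv-β-suc : ∀ n f → conv f (λ i → β (suc i)) n ≡ conv f β (suc n) - f (suc n)
conv-β-suc n f = begin
  c                                 ≡⟨ cancel c (f (suc n)) ⟩
  c + f (suc n) * 1ℚ - f (suc n)    ≡⟨ cong (_- f (suc n)) (conv-sucʳ n f β) ⟨
  conv f β (suc n) - f (suc n)      ∎
  where
  open ≡-Reasoning
  c = conv f (λ i → β (suc i)) n
  cancel : ∀ x y → x ≡ x + y * 1ℚ - y
  cancel = solve-∀ ℚ-ring

conv-θf-β : ∀ n f → conv (θ f) β (suc n) ≡ fromℕ (suc n) * conv f β (suc n) - conv f β n
conv-θf-β n f = begin
  c                                              ≡⟨ cancel c _ ⟩
  c + conv f (θ β) (suc n) - conv f (θ β) (suc n) ≡⟨ cong₂ _-_ (sym (conv-leibniz (suc n) f β)) (conv-θβ n f) ⟩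
  fromℕ (suc n) * conv f β (suc n) - conv f β n  ∎
  where
  open ≡-Reasoning
  c = conv (θ f) β (suc n)
  cancel : ∀ x y → x ≡ x + y - y
  cancel = solve-∀ ℚ-ring

-- Only the equation of `β` enters. It lowers the index in the mixed term of the second-order
-- Leibniz rule, and the remaining `θ f` is removed by `conv-θf-β`. What stays is `θ (θ f)`, to be
-- evaluated for `α` and `αH`.
conv-β-rec : ∀ m f → let n = suc (suc m) in
  fromℕ n * fromℕ n * conv f β n
    ≡ conv (θ (θ f)) β n + (fromℕ n + fromℕ n - 1ℚ) * conv f β (suc m) - conv f β m
conv-β-rec m f = begin
  fromℕ n * fromℕ n * conv f β n
    ≡⟨ conv-leibniz² n f β ⟩
  T + (conv (θ f) (θ β) n + conv (θ f) (θ β) n) + conv f (θ (θ β)) n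
    ≡⟨ cong₂ (λ x y → T + (x + x) + y) (trans (conv-θβ (suc m) (θ f)) (conv-θf-β m f)) third ⟩
  T + (N * G - conv f β m + (N * G - conv f β m)) + (conv f β m + G)
    ≡⟨ collect T N G (conv f β m) ⟩
  T + ((1ℚ + N) + (1ℚ + N) - 1ℚ) * G - conv f β m
    ≡⟨ cong (λ z → T + (z + z - 1ℚ) * G - conv f β m) (fromℕ-suc (suc m)) ⟨
  T + (fromℕ n + fromℕ n - 1ℚ) * G - conv f β m ∎
  where
  open ≡-Reasoning
  n = suc (suc m)
  N = fromℕ (suc m)
  T = conv (θ (θ f)) β n
  G = conv f β (suc m)
  collect : ∀ T N G F → T + (N * G - F + (N * G - F)) + (F + G) ≡ T + ((1ℚ + N) + (1ℚ + N) - 1ℚ) * G - F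
  collect = solve-∀ ℚ-ring
  third : conv f (θ (θ β)) n ≡ conv f β m + G
  third = trans (conv-θʳ-suc (suc m) f (θ β)) (trans (conv-congʳ (suc m) f θθβ-suc)
    (trans (conv-+ʳ (suc m) f (θ β) β) (cong (_+ G) (conv-θβ m f))))

conv-αβ-rec : ∀ m → let n = suc (suc m) in
  fromℕ n * fromℕ n * conv α β n
    ≡ (fromℕ n + fromℕ n) * conv α β (suc m) - conv α β m
conv-αβ-rec m = begin
  fromℕ n * fromℕ n * conv α β n
    ≡⟨ conv-β-rec m α ⟩
  conv (θ (θ α)) β n + (fromℕ n + fromℕ n - 1ℚ) * G - conv α β m
    ≡⟨ cong (λ z → z + (fromℕ n + fromℕ n - 1ℚ) * G - conv α β m)
            (trans (conv-θˡ-suc (suc m) (θ α) β) (conv-congˡ (suc m) β θθα-suc)) ⟩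
  G + (fromℕ n + fromℕ n - 1ℚ) * G - conv α β m
    ≡⟨ collect (fromℕ n) G (conv α β m) ⟩
  (fromℕ n + fromℕ n) * G - conv α β m ∎
  where
  open ≡-Reasoning
  n = suc (suc m)
  G = conv α β (suc m)
  collect : ∀ N G F → G + (N + N - 1ℚ) * G - F ≡ (N + N) * G - F
  collect = solve-∀ ℚ-ring

conv-αHβ-rec : ∀ m → let n = suc (suc m) in
  fromℕ n * fromℕ n * conv αH β n
    ≡ (fromℕ n + fromℕ n) * conv αH β (suc m) - conv αH β m + conv (θ α) β n
conv-αHβ-rec m = begin
  fromℕ n * fromℕ n * conv αH β n
    ≡⟨ conv-β-rec m αH ⟩
  conv (θ (θ αH)) β n + (fromℕ n + fromℕ n - 1ℚ) * G - conv αH β m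
    ≡⟨ cong (λ z → z + (fromℕ n + fromℕ n - 1ℚ) * G - conv αH β m) first ⟩
  G + R + (fromℕ n + fromℕ n - 1ℚ) * G - conv αH β m
    ≡⟨ collect (fromℕ n) G (conv αH β m) R ⟩
  (fromℕ n + fromℕ n) * G - conv αH β m + R ∎
  where
  open ≡-Reasoning
  n = suc (suc m)
  G = conv αH β (suc m)
  R = conv (θ α) β n
  collect : ∀ N G F R → G + R + (N + N - 1ℚ) * G - F ≡ (N + N) * G - F + R
  collect = solve-∀ ℚ-ring
  first : conv (θ (θ αH)) β n ≡ G + R
  first = trans (conv-θˡ-suc (suc m) (θ αH) β) (trans (conv-congˡ (suc m) β θθαH-suc)
    (trans (conv-+ˡ (suc m) αH (λ j → θ α (suc j)) β) (cong (λ z → G + z) (sym (conv-θˡ-suc (suc m) α β)))))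

-- The source `conv (θ α) β n` occurs twice here and once in `conv-αHβ-rec`; the two further terms
-- are boundary summands from `conv-β-suc`.
conv-αβH-rec : ∀ m → let n = suc (suc m) in
  fromℕ n * fromℕ n * conv α βH n
    ≡ (fromℕ n + fromℕ n) * conv α βH (suc m) - conv α βH m + (conv (θ α) β n + conv (θ α) β n)
      + α (suc m) - (θ α n + θ α n)
conv-αβH-rec m = begin
  fromℕ n * fromℕ n * conv α βH n
    ≡⟨ conv-leibniz² n α βH ⟩
  conv (θ (θ α)) βH n + (conv (θ α) (θ βH) n + conv (θ α) (θ βH) n) + conv α (θ (θ βH)) n
    ≡⟨ cong₂ _+_ (cong₂ (λ x y → x + (y + y)) first second) third ⟩
  F + (N * F - (F₀ + (S - a)) + (R - t) + (N * F - (F₀ + (S - a)) + (R - t))) + (F₀ + (S - a) + (F + S))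
    ≡⟨ collect N F F₀ S R a t ⟩
  ((1ℚ + N) + (1ℚ + N)) * F - F₀ + (R + R) + a - (t + t)
    ≡⟨ cong (λ z → (z + z) * F - F₀ + (R + R) + a - (t + t)) (fromℕ-suc (suc m)) ⟨
  (fromℕ n + fromℕ n) * F - F₀ + (R + R) + a - (t + t) ∎
  where
  open ≡-Reasoning
  n  = suc (suc m)
  N  = fromℕ (suc m)
  F  = conv α βH (suc m)
  F₀ = conv α βH m
  S  = conv α β (suc m)
  R  = conv (θ α) β n
  a  = α (suc m)
  t  = θ α n
  collect : ∀ N F F₀ S R a t →
    F + (N * F - (F₀ + (S - a)) + (R - t) + (N * F - (F₀ + (S - a)) + (R - t))) + (F₀ + (S - a) + (F + S))
    ≡ ((1ℚ + N) + (1ℚ + N)) * F - F₀ + (R + R) + a - (t + t)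
  collect = solve-∀ ℚ-ring
  cancel : ∀ x y → x ≡ x + y - y
  cancel = solve-∀ ℚ-ring

  conv-θβH : ∀ n f → conv f (θ βH) (suc n) ≡ conv f βH n + (conv f β (suc n) - f (suc n))
  conv-θβH n f = trans (conv-θʳ-suc n f βH) (trans (conv-congʳ n f θβH-suc)
    (trans (conv-+ʳ n f βH (λ i → β (suc i))) (cong (λ z → conv f βH n + z) (conv-β-suc n f))))

  first : conv (θ (θ α)) βH n ≡ F
  first = trans (conv-θˡ-suc (suc m) (θ α) βH) (conv-congˡ (suc m) βH θθα-suc)

  θαβH : conv (θ α) βH (suc m) ≡ N * F - (F₀ + (S - a))
  θαβH = trans (cancel _ (conv α (θ βH) (suc m)))
    (cong₂ _-_ (sym (conv-leibniz (suc m) α βH)) (conv-θβH m α))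

  second : conv (θ α) (θ βH) n ≡ N * F - (F₀ + (S - a)) + (R - t)
  second = trans (conv-θβH (suc m) (θ α)) (cong (_+ (R - t)) θαβH)

  θθβH-suc : ∀ i → θ (θ βH) (suc i) ≡ θ βH i + (βH i + β i)
  θθβH-suc i = begin
    fromℕ (suc i) * θ βH (suc i)                     ≡⟨ cong (fromℕ (suc i) *_) (θβH-suc i) ⟩
    fromℕ (suc i) * (βH i + β (suc i))               ≡⟨ *-distribˡ-+ (fromℕ (suc i)) (βH i) (β (suc i)) ⟩
    fromℕ (suc i) * βH i + θ β (suc i)               ≡⟨ cong₂ (λ x y → x * βH i + y) (fromℕ-suc i) (θβ-suc i) ⟩
    (1ℚ + fromℕ i) * βH i + β i                      ≡⟨ regroup (fromℕ i) (βH i) (β i) ⟩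
    θ βH i + (βH i + β i)                            ∎
    where
    regroup : ∀ i x y → (1ℚ + i) * x + y ≡ i * x + (x + y)
    regroup = solve-∀ ℚ-ring

  third : conv α (θ (θ βH)) n ≡ F₀ + (S - a) + (F + S)
  third = trans (conv-θʳ-suc (suc m) α (θ βH)) (trans (conv-congʳ (suc m) α θθβH-suc)
    (trans (conv-+ʳ (suc m) α (θ βH) (λ i → βH i + β i))
      (cong₂ _+_ (conv-θβH m α) (conv-+ʳ (suc m) α βH β))))

-- In the combination 2, -1 the sources `conv (θ α) β n` of the two recurrences cancel, and only
-- boundary terms survive.
P̂ : ℕ → ℚ
P̂ n = conv αH β n + conv αH β n - conv α βH n

P̂-rec : ∀ m → let n = suc (suc m) in
  fromℕ n * fromℕ n * P̂ n ≡ (fromℕ n + fromℕ n) * P̂ (suc m) - P̂ m - fromℕ m * (+ 1 / n) * α (suc m)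
P̂-rec m = begin
  N * N * (A + A - B)
    ≡⟨ distrib N A B ⟩
  N * N * A + N * N * A - N * N * B
    ≡⟨ cong₂ (λ x y → x + x - y) (conv-αHβ-rec m) (conv-αβH-rec m) ⟩
  _ ≡⟨ collect N (conv αH β (suc m)) (conv αH β m) R (conv α βH (suc m)) (conv α βH m) a t ⟩
  (N + N) * P̂ (suc m) - P̂ m - (a - (t + t))
    ≡⟨ cong (λ z → (N + N) * P̂ (suc m) - P̂ m - z) error ⟩
  (N + N) * P̂ (suc m) - P̂ m - fromℕ m * r * a ∎
  where
  open ≡-Reasoning
  n = suc (suc m)
  N = fromℕ n
  A = conv αH β n
  B = conv α βH n
  R = conv (θ α) β n
  a = α (suc m)
  t = θ α n
  r = + 1 / n
  distrib : ∀ n a b → n * n * (a + a - b) ≡ n * n * a + n * n * a - n * n * b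
  distrib = solve-∀ ℚ-ring
  collect : ∀ N A A₀ R B B₀ a t →
    (N + N) * A - A₀ + R + ((N + N) * A - A₀ + R) - ((N + N) * B - B₀ + (R + R) + a - (t + t))
    ≡ (N + N) * (A + A - B) - (A₀ + A₀ - B₀) - (a - (t + t))
  collect = solve-∀ ℚ-ring
  one : ∀ a r → a - (a * r + a * r) ≡ a * 1ℚ - (a * r + a * r)
  one = solve-∀ ℚ-ring
  two : ∀ a m r → a * ((1ℚ + (1ℚ + m)) * r) - (a * r + a * r) ≡ m * r * a
  two = solve-∀ ℚ-ring
  -- Since `t` is `a / n`, the boundary terms combine to the factor 1 - 2/n = (n - 2)/n.
  error : a - (t + t) ≡ fromℕ m * r * a
  error = begin
    a - (t + t)                                    ≡⟨ cong (λ z → a - (z + z)) (θα-suc (suc m)) ⟩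
    a - (a * r + a * r)                            ≡⟨ one a r ⟩
    a * 1ℚ - (a * r + a * r)                       ≡⟨ cong (λ z → a * z - (a * r + a * r)) (n*1/n≡1 (suc m)) ⟨
    a * (N * r) - (a * r + a * r)                  ≡⟨ cong (λ z → a * (z * r) - (a * r + a * r))
                                                           (trans (fromℕ-suc (suc m)) (cong (λ z → 1ℚ + z) (fromℕ-suc m))) ⟩
    a * ((1ℚ + (1ℚ + fromℕ m)) * r) - (a * r + a * r) ≡⟨ two a (fromℕ m) r ⟩
    fromℕ m * r * a                                ∎

-- The recurrences of p and q

infix 8 _!ℚ
_!ℚ : ℕ → ℚ
n !ℚ = fromℕ (n !)

!ℚ-suc : ∀ n → suc n !ℚ ≡ fromℕ (suc n) * n !ℚ
!ℚ-suc n = fromℕ-* (suc n) (n !)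

n!*βn≡1 : ∀ n → n !ℚ * β n ≡ 1ℚ
n!*βn≡1 zero    = refl
n!*βn≡1 (suc n) = begin
  suc n !ℚ * (β n * r)              ≡⟨ cong (_* (β n * r)) (!ℚ-suc n) ⟩
  fromℕ (suc n) * n !ℚ * (β n * r)  ≡⟨ regroup (fromℕ (suc n)) (n !ℚ) (β n) r ⟩
  (n !ℚ * β n) * (fromℕ (suc n) * r) ≡⟨ cong₂ _*_ (n!*βn≡1 n) (n*1/n≡1 n) ⟩
  1ℚ * 1ℚ                           ≡⟨⟩
  1ℚ                                ∎
  where
  open ≡-Reasoning
  r = + 1 / suc n
  regroup : ∀ a f b r → a * f * (b * r) ≡ f * b * (a * r)
  regroup = solve-∀ ℚ-ring

[j+i]Ci*i!*j!≡[j+i]! : ∀ j i → ((j ℕ.+ i) C i) ℕ.* (i ! ℕ.* j !) ≡ (j ℕ.+ i) !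
[j+i]Ci*i!*j!≡[j+i]! j i = subst (λ k → ((j ℕ.+ i) C i) ℕ.* (i ! ℕ.* k !) ≡ (j ℕ.+ i) !) (ℕ.m+n∸n≡m j i)
  (trans (cong (ℕ._* (i ! ℕ.* (j ℕ.+ i ℕ.∸ i) !)) (nCk≡n!/k![n-k]! i≤j+i))
         (m/n*n≡m {{ℕ._!*_!≢0 i (j ℕ.+ i ℕ.∸ i)}} (k![n∸k]!∣n! i≤j+i)))
  where i≤j+i = ℕ.m≤n+m i j

q-term : ∀ j i → fromℕ (((j ℕ.+ i) C i) ℕ.^ 2 ℕ.* i !) ≡ (j ℕ.+ i) !ℚ * (j ℕ.+ i) !ℚ * (α j * β i)
q-term j i = begin
  fromℕ (c ℕ.^ 2 ℕ.* i !)
    ≡⟨ trans (fromℕ-* (c ℕ.^ 2) (i !)) (cong (_* Y) (trans (fromℕ-* c (c ℕ.* 1)) (cong (λ k → X * fromℕ k) (ℕ.*-identityʳ c)))) ⟩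
  X * X * Y
    -- Three of the factors 1 become i! · `β i` and two become j! · `β j`. This completes the square
    -- of `X * (Y * Z)`, which is (j + i)!, and leaves (i! · `β i`)² over.
    ≡⟨ insert X Y ⟩
  X * X * Y * (1ℚ * 1ℚ * 1ℚ * 1ℚ * 1ℚ)
    ≡⟨ cong₂ (λ x y → X * X * Y * (x * x * y * y * x)) (sym (n!*βn≡1 i)) (sym (n!*βn≡1 j)) ⟩
  X * X * Y * (Y * β i * (Y * β i) * (Z * β j) * (Z * β j) * (Y * β i))
    ≡⟨ regroup X Y Z (β i) (β j) ⟩
  X * (Y * Z) * (X * (Y * Z)) * (α j * β i) * (Y * β i * (Y * β i))
    ≡⟨ cong₂ (λ x y → x * x * (α j * β i) * (y * y)) factorials (n!*βn≡1 i) ⟩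
  F * F * (α j * β i) * (1ℚ * 1ℚ)
    ≡⟨ *-identityʳ (F * F * (α j * β i)) ⟩
  F * F * (α j * β i) ∎
  where
  open ≡-Reasoning
  c = (j ℕ.+ i) C i
  X = fromℕ c
  Y = i !ℚ
  Z = j !ℚ
  F = (j ℕ.+ i) !ℚ
  insert : ∀ c i → c * c * i ≡ c * c * i * (1ℚ * 1ℚ * 1ℚ * 1ℚ * 1ℚ)
  insert = solve-∀ ℚ-ring
  regroup : ∀ c i j x y → c * c * i * (i * x * (i * x) * (j * y) * (j * y) * (i * x))
            ≡ c * (i * j) * (c * (i * j)) * (y * y * x) * (i * x * (i * x))
  regroup = solve-∀ ℚ-ring
  factorials : X * (Y * Z) ≡ F
  factorials = trans (cong (X *_) (sym (fromℕ-* (i !) (j !))))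
    (trans (sym (fromℕ-* c (i ! ℕ.* j !))) (cong fromℕ ([j+i]Ci*i!*j!≡[j+i]! j i)))

fromℕ-sum : ∀ n (f g : ℕ → ℕ) →
  fromℕ (sum (map f (applyUpTo g (suc n)))) ≡ ∑↗ n λ _ i → fromℕ (f (g i))
fromℕ-sum zero    f g = cong fromℕ (ℕ.+-identityʳ (f (g 0)))
fromℕ-sum (suc n) f g = trans (fromℕ-+ (f (g 0)) _)
  (trans (+-comm (fromℕ (f (g 0))) _)
  (trans (cong (_+ fromℕ (f (g 0))) (fromℕ-sum n f (λ k → g (suc k))))
         (sym (∑↗-peelʳ n λ _ i → fromℕ (f (g i))))))

q≡ : ∀ n → fromℕ (q n) ≡ n !ℚ * n !ℚ * conv α β n
q≡ n = trans (fromℕ-sum n (λ k → (n C k) ℕ.^ 2 ℕ.* k !) (λ k → k))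
  (trans (∑↗-cong n λ { j i refl → q-term j i }) (∑↗-*ˡ n (n !ℚ * n !ℚ) _))

p : ℕ → ℚ
p n = n !ℚ * n !ℚ * P̂ n

-- The recurrence is multiplied by (n - 1)!², which turns n² into the factor completing n!² and
-- cancels `α (suc m)` against the error coefficient `e`.
!ℚ²-rec : ∀ m x₂ x₁ x₀ e → let n = suc (suc m) in
  fromℕ n * fromℕ n * x₂ ≡ (fromℕ n + fromℕ n) * x₁ - x₀ - e * α (suc m) →
  n !ℚ * n !ℚ * x₂ ≡ (fromℕ n + fromℕ n) * (suc m !ℚ * suc m !ℚ * x₁)
                     - fromℕ (suc m) * fromℕ (suc m) * (m !ℚ * m !ℚ * x₀) - e
!ℚ²-rec m x₂ x₁ x₀ e rec = begin
  n !ℚ * n !ℚ * x₂                                       ≡⟨ cong (λ f → f * f * x₂) (!ℚ-suc (suc m)) ⟩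
  N * F₁ * (N * F₁) * x₂                                 ≡⟨ swap N F₁ x₂ ⟩
  F₁ * F₁ * (N * N * x₂)                                 ≡⟨ cong (F₁ * F₁ *_) rec ⟩
  F₁ * F₁ * ((N + N) * x₁ - x₀ - e * (b * b))            ≡⟨ distrib F₁ N x₁ x₀ e b ⟩
  (N + N) * (F₁ * F₁ * x₁) - F₁ * F₁ * x₀ - e * (F₁ * b * (F₁ * b))
    ≡⟨ cong₂ (λ f g → (N + N) * (F₁ * F₁ * x₁) - f * f * x₀ - e * (g * g)) (!ℚ-suc m) (n!*βn≡1 (suc m)) ⟩
  (N + N) * (F₁ * F₁ * x₁) - M * F₀ * (M * F₀) * x₀ - e * (1ℚ * 1ℚ)
    ≡⟨ tidy ((N + N) * (F₁ * F₁ * x₁)) M F₀ x₀ e ⟩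
  (N + N) * (F₁ * F₁ * x₁) - M * M * (F₀ * F₀ * x₀) - e  ∎
  where
  open ≡-Reasoning
  n  = suc (suc m)
  N  = fromℕ n
  M  = fromℕ (suc m)
  F₁ = suc m !ℚ
  F₀ = m !ℚ
  b  = β (suc m)
  swap : ∀ n f x → n * f * (n * f) * x ≡ f * f * (n * n * x)
  swap = solve-∀ ℚ-ring
  distrib : ∀ f n x y e b → f * f * ((n + n) * x - y - e * (b * b))
            ≡ (n + n) * (f * f * x) - f * f * y - e * (f * b * (f * b))
  distrib = solve-∀ ℚ-ring
  tidy : ∀ z m f x e → z - m * f * (m * f) * x - e * (1ℚ * 1ℚ) ≡ z - m * m * (f * f * x) - e
  tidy = solve-∀ ℚ-ring

p-rec : ∀ m → let n = suc (suc m) in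
  p n ≡ (fromℕ n + fromℕ n) * p (suc m) - fromℕ (suc m) * fromℕ (suc m) * p m - fromℕ m * (+ 1 / n)
p-rec m = !ℚ²-rec m _ _ _ _ (P̂-rec m)

q-rec : ∀ m → let n = suc (suc m) in
  fromℕ (q n) ≡ (fromℕ n + fromℕ n) * fromℕ (q (suc m)) - fromℕ (suc m) * fromℕ (suc m) * fromℕ (q m)
q-rec m = begin
  fromℕ (q n)            ≡⟨ q≡ n ⟩
  n !ℚ * n !ℚ * c n      ≡⟨ !ℚ²-rec m _ _ _ 0ℚ (trans (conv-αβ-rec m) (pad _ (α (suc m)))) ⟩
  (N + N) * (suc m !ℚ * suc m !ℚ * c (suc m)) - M * M * (m !ℚ * m !ℚ * c m) - 0ℚ
                         ≡⟨ unpad _ ⟩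
  (N + N) * (suc m !ℚ * suc m !ℚ * c (suc m)) - M * M * (m !ℚ * m !ℚ * c m)
                         ≡⟨ cong₂ (λ x y → (N + N) * x - M * M * y) (q≡ (suc m)) (q≡ m) ⟨
  (N + N) * fromℕ (q (suc m)) - M * M * fromℕ (q m) ∎
  where
  open ≡-Reasoning
  n = suc (suc m)
  N = fromℕ n
  M = fromℕ (suc m)
  c = conv α β
  pad : ∀ x a → x ≡ x - 0ℚ * a
  pad = solve-∀ ℚ-ring
  unpad : ∀ x → x - 0ℚ ≡ x
  unpad = solve-∀ ℚ-ring

-- The recurrence of Δ and the continued fraction

fromℕ-pos : ∀ n .{{_ : ℕ.NonZero n}} → Positive (fromℕ n)
fromℕ-pos n = normalize-pos n 1

*-cancelˡ-≡-pos : ∀ r .{{_ : Positive r}} {x y} → r * x ≡ r * y → x ≡ y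
*-cancelˡ-≡-pos r eq = ≤-antisym (*-cancelˡ-≤-pos r (≤-reflexive eq)) (*-cancelˡ-≤-pos r (≤-reflexive (sym eq)))

fromℕ-^ : ∀ n k → fromℕ (n ℕ.^ suc k) ≡ fromℕ n * fromℕ (n ℕ.^ k)
fromℕ-^ n k = fromℕ-* n (n ℕ.^ k)

fromℕ-^2 : ∀ n → fromℕ (n ℕ.^ 2) ≡ fromℕ n * fromℕ n
fromℕ-^2 n = trans (fromℕ-^ n 1) (cong (fromℕ n *_) (trans (fromℕ-^ n 0) (*-identityʳ (fromℕ n))))

fromℕ-∸1 : ∀ n → fromℕ n ≡ fromℕ (suc n) - fromℕ 1
fromℕ-∸1 n = trans (cancel (fromℕ n)) (cong (_- fromℕ 1) (sym (fromℕ-suc n)))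
  where
  cancel : ∀ x → x ≡ 1ℚ + x - fromℕ 1
  cancel = solve-∀ ℚ-ring

fromℕ-∸2 : ∀ n → fromℕ n ≡ fromℕ (suc (suc n)) - fromℕ 2
fromℕ-∸2 n = trans (cancel (fromℕ n)) (cong (_- fromℕ 2) (sym (trans (fromℕ-suc (suc n)) (cong (λ z → 1ℚ + z) (fromℕ-suc n)))))
  where
  cancel : ∀ x → x ≡ 1ℚ + (1ℚ + x) - fromℕ 2
  cancel = solve-∀ ℚ-ring

module Recurrence
  (Δ : ℕ → ℚ)
  (Δ1 : Δ 1 ≡ fromℤ (-ℤ + 1))
  (Δ2 : Δ 2 ≡ fromℤ (-ℤ + 2))
  (Δ3 : Δ 3 ≡ fromℤ (-ℤ + 5))
  (Δ4 : Δ 4 ≡ fromℤ (+ 8))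
  (rec : ∀ n → 3 ℕ.≤ n →
      (fromℕ n - fromℕ 1) * (fromℕ n - fromℕ 2) * Δ (n ℕ.+ 2)
        ≡ (fromℕ n - fromℕ 2) * (fromℕ n + fromℕ 1) * (fromℕ (n ℕ.^ 2) + fromℕ (3 ℕ.* n) - fromℕ 2) * Δ (n ℕ.+ 1)
          - fromℕ (n ℕ.^ 2) * (fromℕ (2 ℕ.* n ℕ.^ 3) + fromℕ (n ℕ.^ 2) - fromℕ (7 ℕ.* n) - fromℕ 4) * Δ n
          + fromℕ ((n ℕ.∸ 1) ℕ.^ 2 ℕ.* n ℕ.^ 4) * Δ (n ℕ.∸ 1))
  where

  -- The right side becomes a polynomial in `N`, as the ring solver requires. The left factors
  -- remain images of positive naturals, so that they can be cancelled.
  rec-polynomial : ∀ m → let n = suc (suc (suc m)) ; N = fromℕ n in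
    fromℕ (suc (suc m)) * fromℕ (suc m) * Δ (suc (suc n))
      ≡ (N - fromℕ 2) * (N + fromℕ 1) * (N * N + fromℕ 3 * N - fromℕ 2) * Δ (suc n)
        - N * N * (fromℕ 2 * (N * (N * N)) + N * N - fromℕ 7 * N - fromℕ 4) * Δ n
        + (N - fromℕ 1) * (N - fromℕ 1) * (N * (N * (N * N))) * Δ (suc (suc m))
  rec-polynomial m = begin
    fromℕ (suc (suc m)) * fromℕ (suc m) * Δ (suc (suc n))
      ≡⟨ cong₂ (λ x y → x * y * Δ (suc (suc n))) (fromℕ-∸1 (suc (suc m))) (fromℕ-∸2 (suc m)) ⟩
    (N - fromℕ 1) * (N - fromℕ 2) * Δ (suc (suc n))
      ≡⟨ cong (λ k → (N - fromℕ 1) * (N - fromℕ 2) * Δ k) (ℕ.+-comm n 2) ⟨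
    (N - fromℕ 1) * (N - fromℕ 2) * Δ (n ℕ.+ 2)
      ≡⟨ rec n (ℕ.s≤s (ℕ.s≤s (ℕ.s≤s ℕ.z≤n))) ⟩
    (N - fromℕ 2) * (N + fromℕ 1) * (fromℕ (n ℕ.^ 2) + fromℕ (3 ℕ.* n) - fromℕ 2) * Δ (n ℕ.+ 1)
      - fromℕ (n ℕ.^ 2) * (fromℕ (2 ℕ.* n ℕ.^ 3) + fromℕ (n ℕ.^ 2) - fromℕ (7 ℕ.* n) - fromℕ 4) * Δ n
      + fromℕ (suc (suc m) ℕ.^ 2 ℕ.* n ℕ.^ 4) * Δ (suc (suc m))
      ≡⟨ cong₂ (λ x y → x + y * Δ (suc (suc m)))
           (cong₂ _-_
             (trans (cong (λ k → (N - fromℕ 2) * (N + fromℕ 1) * (fromℕ (n ℕ.^ 2) + fromℕ (3 ℕ.* n) - fromℕ 2) * Δ k) (ℕ.+-comm n 1))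
               (cong₂ (λ x y → (N - fromℕ 2) * (N + fromℕ 1) * (x + y - fromℕ 2) * Δ (suc n)) n² (fromℕ-* 3 n)))
             (trans (cong₂ (λ x y → fromℕ (n ℕ.^ 2) * (x + fromℕ (n ℕ.^ 2) - y - fromℕ 4) * Δ n)
                           (trans (fromℕ-* 2 (n ℕ.^ 3)) (cong (fromℕ 2 *_) n³)) (fromℕ-* 7 n))
               (cong (λ x → x * (fromℕ 2 * (N * (N * N)) + x - fromℕ 7 * N - fromℕ 4) * Δ n) n²)))
           (trans (fromℕ-* (suc (suc m) ℕ.^ 2) (n ℕ.^ 4))
             (cong₂ _*_ (trans (fromℕ-^2 (suc (suc m))) (cong (λ x → x * x) (fromℕ-∸1 (suc (suc m)))))
                        (trans (fromℕ-^ n 3) (cong (N *_) n³)))) ⟩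
    _ ∎
    where
    open ≡-Reasoning
    n = suc (suc (suc m))
    N = fromℕ n
    n² = fromℕ-^2 n
    n³ = trans (fromℕ-^ n 2) (cong (N *_) n²)

  -- The two hypotheses express both middle values of Δ through `a`, `u` and `v`, and `q-rec` does
  -- the same for the newest value of `q`. Then `eliminate` is a polynomial identity in independent
  -- variables, and the factor (n - 1)(n - 2) is nonzero because n ≥ 3.
  Δ-step : ∀ m →
    Δ (3 ℕ.+ m) ≡ fromℕ (3 ℕ.+ m) * fromℕ (2 ℕ.+ m) * Δ (2 ℕ.+ m) + fromℕ (1 ℕ.+ m) * fromℕ (q (2 ℕ.+ m)) →
    Δ (4 ℕ.+ m) ≡ fromℕ (4 ℕ.+ m) * fromℕ (3 ℕ.+ m) * Δ (3 ℕ.+ m) + fromℕ (2 ℕ.+ m) * fromℕ (q (3 ℕ.+ m)) →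
    Δ (5 ℕ.+ m) ≡ fromℕ (5 ℕ.+ m) * fromℕ (4 ℕ.+ m) * Δ (4 ℕ.+ m) + fromℕ (3 ℕ.+ m) * fromℕ (q (4 ℕ.+ m))
  Δ-step m e₁ e₂ = *-cancelˡ-≡-pos (N₋₁ * N₋₂) {{pos*pos⇒pos N₋₁ {{fromℕ-pos (2 ℕ.+ m)}} N₋₂ {{fromℕ-pos (1 ℕ.+ m)}}}} (begin
    N₋₁ * N₋₂ * Δ (5 ℕ.+ m)
      ≡⟨ rec-polynomial m ⟩
    R N (Δ (4 ℕ.+ m)) (Δ (3 ℕ.+ m)) a
      ≡⟨ cong₂ (λ x y → R N x y a) (trans e₂ (cong₂ (λ x y → x * N * y + N₋₁ * u) N₊₁≡ e₁′)) e₁′ ⟩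
    R N ((N + 1ℚ) * N * b + N₋₁ * u) b a
      ≡⟨ cong (λ x → R N ((N + 1ℚ) * N * b + x * u) b a) (fromℕ-∸1 (2 ℕ.+ m)) ⟩
    R N ((N + 1ℚ) * N * b + (N - fromℕ 1) * u) b a
      ≡⟨ eliminate N u v a ⟩
    (N - fromℕ 1) * (N - fromℕ 2) * ((N + 1ℚ + 1ℚ) * (N + 1ℚ) * ((N + 1ℚ) * N * b + (N - fromℕ 1) * u) + N * ((N + 1ℚ + (N + 1ℚ)) * u - N * N * v))
      ≡⟨ cong₂ (λ x y → x * y * ((N + 1ℚ + 1ℚ) * (N + 1ℚ) * ((N + 1ℚ) * N * b + x * u) + N * ((N + 1ℚ + (N + 1ℚ)) * u - N * N * v)))
               (fromℕ-∸1 (2 ℕ.+ m)) (fromℕ-∸2 (1 ℕ.+ m)) ⟨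
    N₋₁ * N₋₂ * ((N + 1ℚ + 1ℚ) * (N + 1ℚ) * ((N + 1ℚ) * N * b + N₋₁ * u) + N * ((N + 1ℚ + (N + 1ℚ)) * u - N * N * v))
      ≡⟨ cong₂ (λ x y → N₋₁ * N₋₂ * ((x + 1ℚ) * x * (x * N * y + N₋₁ * u) + N * ((x + x) * u - N * N * v))) N₊₁≡ e₁′ ⟨
    N₋₁ * N₋₂ * ((N₊₁ + 1ℚ) * N₊₁ * (N₊₁ * N * Δ (3 ℕ.+ m) + N₋₁ * u) + N * ((N₊₁ + N₊₁) * u - N * N * v))
      ≡⟨ cong₂ (λ x y → N₋₁ * N₋₂ * (x * N₊₁ * y + N * ((N₊₁ + N₊₁) * u - N * N * v))) (trans (fromℕ-suc (4 ℕ.+ m)) (+-comm 1ℚ N₊₁)) e₂ ⟨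
    N₋₁ * N₋₂ * (fromℕ (5 ℕ.+ m) * N₊₁ * Δ (4 ℕ.+ m) + N * ((N₊₁ + N₊₁) * u - N * N * v))
      ≡⟨ cong (λ x → N₋₁ * N₋₂ * (fromℕ (5 ℕ.+ m) * N₊₁ * Δ (4 ℕ.+ m) + N * x)) (q-rec (2 ℕ.+ m)) ⟨
    N₋₁ * N₋₂ * (fromℕ (5 ℕ.+ m) * N₊₁ * Δ (4 ℕ.+ m) + N * fromℕ (q (4 ℕ.+ m))) ∎)
    where
    open ≡-Reasoning
    N   = fromℕ (3 ℕ.+ m)
    N₊₁ = fromℕ (4 ℕ.+ m)
    N₋₁ = fromℕ (2 ℕ.+ m)
    N₋₂ = fromℕ (1 ℕ.+ m)
    u   = fromℕ (q (3 ℕ.+ m))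
    v   = fromℕ (q (2 ℕ.+ m))
    a   = Δ (2 ℕ.+ m)
    b   = N * (N - fromℕ 1) * a + (N - fromℕ 2) * v
    R : ℚ → ℚ → ℚ → ℚ → ℚ
    R N c b a = (N - fromℕ 2) * (N + fromℕ 1) * (N * N + fromℕ 3 * N - fromℕ 2) * c
        - N * N * (fromℕ 2 * (N * (N * N)) + N * N - fromℕ 7 * N - fromℕ 4) * b
        + (N - fromℕ 1) * (N - fromℕ 1) * (N * (N * (N * N))) * a
    N₊₁≡ : N₊₁ ≡ N + 1ℚ
    N₊₁≡ = trans (fromℕ-suc (3 ℕ.+ m)) (+-comm 1ℚ N)
    e₁′ : Δ (3 ℕ.+ m) ≡ b
    e₁′ = trans e₁ (cong₂ (λ x y → N * x * a + y * v) (fromℕ-∸1 (2 ℕ.+ m)) (fromℕ-∸2 (1 ℕ.+ m)))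
    eliminate : ∀ N u v a → let b = N * (N - fromℕ 1) * a + (N - fromℕ 2) * v ; c = (N + 1ℚ) * N * b + (N - fromℕ 1) * u in
      (N - fromℕ 2) * (N + fromℕ 1) * (N * N + fromℕ 3 * N - fromℕ 2) * c
        - N * N * (fromℕ 2 * (N * (N * N)) + N * N - fromℕ 7 * N - fromℕ 4) * b
        + (N - fromℕ 1) * (N - fromℕ 1) * (N * (N * (N * N))) * a
      ≡ (N - fromℕ 1) * (N - fromℕ 2) * ((N + 1ℚ + 1ℚ) * (N + 1ℚ) * c + N * ((N + 1ℚ + (N + 1ℚ)) * u - N * N * v))
    eliminate = solve-∀ ℚ-ring

  -- The prescribed values satisfy the relation by evaluation: -2 = 2·(-1) + 0, -5 = 6·(-2) + 7 and
  -- 8 = 12·(-5) + 2·34. The last two of these start the induction.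
  Δ-suc : ∀ m → Δ (suc (suc m)) ≡ fromℕ (suc (suc m)) * fromℕ (suc m) * Δ (suc m) + fromℕ m * fromℕ (q (suc m))
  Δ-suc 0 = trans Δ2 (cong (λ x → fromℕ 2 * fromℕ 1 * x + fromℕ 0 * fromℕ (q 1)) (sym Δ1))
  Δ-suc 1 = trans Δ3 (cong (λ x → fromℕ 3 * fromℕ 2 * x + fromℕ 1 * fromℕ (q 2)) (sym Δ2))
  Δ-suc 2 = trans Δ4 (cong (λ x → fromℕ 4 * fromℕ 3 * x + fromℕ 2 * fromℕ (q 3)) (sym Δ3))
  Δ-suc (suc (suc (suc m))) = Δ-step m (Δ-suc (suc m)) (Δ-suc (suc (suc m)))

  -- Up to the factor n, Δ is the Casoratian of `p` and `q`. The homogeneous parts of their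
  -- recurrences multiply it by (n - 1)², and the source (n - 2)/n of `p` contributes the term with
  -- `q`. The base case evaluates `p 0` to 0 and `p 1` to 1.
  Δ-det : ∀ m → Δ (suc m) ≡ fromℕ (suc m) * (p m * fromℕ (q (suc m)) - p (suc m) * fromℕ (q m))
  Δ-det zero = Δ1
  Δ-det (suc m) = begin
    Δ n
      ≡⟨ Δ-suc m ⟩
    N * M * Δ (suc m) + x * q₁
      ≡⟨ cong (λ z → N * M * z + x * q₁) (Δ-det m) ⟩
    N * M * (M * (p₀ * q₁ - p₁ * q₀)) + x * q₁
      ≡⟨ cong (λ z → N * M * (M * (p₀ * q₁ - p₁ * q₀)) + z) (trans (cong (_* (x * q₁)) (n*1/n≡1 (suc m))) (*-identityˡ _)) ⟨
    N * M * (M * (p₀ * q₁ - p₁ * q₀)) + N * r * (x * q₁)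
      ≡⟨ cross N M p₀ p₁ q₀ q₁ x r ⟩
    N * (p₁ * ((N + N) * q₁ - M * M * q₀) - ((N + N) * p₁ - M * M * p₀ - x * r) * q₁)
      ≡⟨ cong₂ (λ y z → N * (p₁ * y - z * q₁)) (q-rec m) (p-rec m) ⟨
    N * (p₁ * fromℕ (q n) - p n * q₁) ∎
    where
    open ≡-Reasoning
    n  = suc (suc m)
    N  = fromℕ n
    M  = fromℕ (suc m)
    x  = fromℕ m
    r  = + 1 / n
    p₀ = p m
    p₁ = p (suc m)
    q₀ = fromℕ (q m)
    q₁ = fromℕ (q (suc m))
    cross : ∀ N M p₀ p₁ q₀ q₁ x r → N * M * (M * (p₀ * q₁ - p₁ * q₀)) + N * r * (x * q₁)
      ≡ N * (p₁ * ((N + N) * q₁ - M * M * q₀) - ((N + N) * p₁ - M * M * p₀ - x * r) * q₁)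
    cross = solve-∀ ℚ-ring

  d : ℕ → ℕ
  d zero    = 8
  d (suc m) = (5 ℕ.+ m) ℕ.* (4 ℕ.+ m) ℕ.* d m ℕ.+ (3 ℕ.+ m) ℕ.* q (4 ℕ.+ m)

  Δ≡d : ∀ m → Δ (4 ℕ.+ m) ≡ fromℕ (d m)
  Δ≡d zero    = Δ4
  Δ≡d (suc m) = begin
    Δ (5 ℕ.+ m)
      ≡⟨ Δ-suc (3 ℕ.+ m) ⟩
    fromℕ (5 ℕ.+ m) * fromℕ (4 ℕ.+ m) * Δ (4 ℕ.+ m) + fromℕ (3 ℕ.+ m) * fromℕ (q (4 ℕ.+ m))
      ≡⟨ cong₂ (λ x y → x * y + fromℕ (3 ℕ.+ m) * fromℕ (q (4 ℕ.+ m))) (sym (fromℕ-* (5 ℕ.+ m) (4 ℕ.+ m))) (Δ≡d m) ⟩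
    fromℕ ((5 ℕ.+ m) ℕ.* (4 ℕ.+ m)) * fromℕ (d m) + fromℕ (3 ℕ.+ m) * fromℕ (q (4 ℕ.+ m))
      ≡⟨ cong₂ _+_ (fromℕ-* ((5 ℕ.+ m) ℕ.* (4 ℕ.+ m)) (d m)) (fromℕ-* (3 ℕ.+ m) (q (4 ℕ.+ m))) ⟨
    fromℕ ((5 ℕ.+ m) ℕ.* (4 ℕ.+ m) ℕ.* d m) + fromℕ ((3 ℕ.+ m) ℕ.* q (4 ℕ.+ m))
      ≡⟨ fromℕ-+ ((5 ℕ.+ m) ℕ.* (4 ℕ.+ m) ℕ.* d m) ((3 ℕ.+ m) ℕ.* q (4 ℕ.+ m)) ⟨
    fromℕ (d (suc m)) ∎
    where open ≡-Reasoning

  d-pos : ∀ m → 0 ℕ.< d m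
  d-pos zero    = ℕ.s≤s ℕ.z≤n
  d-pos (suc m) = ℕ.≤-trans (q-pos (4 ℕ.+ m))
    (ℕ.≤-trans (ℕ.m≤n*m (q (4 ℕ.+ m)) (3 ℕ.+ m)) (ℕ.m≤n+m _ ((5 ℕ.+ m) ℕ.* (4 ℕ.+ m) ℕ.* d m)))

  Δ-integer : ∀ n → 1 ℕ.≤ n → IsInteger (Δ n)
  Δ-integer 1 _ = -ℤ + 1 , Δ1
  Δ-integer 2 _ = -ℤ + 2 , Δ2
  Δ-integer 3 _ = -ℤ + 5 , Δ3
  Δ-integer (suc (suc (suc (suc m)))) _ = + d m , Δ≡d m

  Δ-positive : ∀ n → 4 ℕ.≤ n → Positive (Δ n)
  Δ-positive (suc (suc (suc (suc m)))) _ = subst Positive (sym (Δ≡d m)) (fromℕ-pos (d m) {{ℕ.>-nonZero (d-pos m)}})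
  Δ-positive 1 (ℕ.s≤s ())
  Δ-positive 2 (ℕ.s≤s (ℕ.s≤s ()))
  Δ-positive 3 (ℕ.s≤s (ℕ.s≤s (ℕ.s≤s ())))

  2∣2n : ∀ n → 2 ℕ.∣ n ℕ.+ n
  2∣2n n = ℕ.divides n (trans (cong (n ℕ.+_) (sym (ℕ.+-identityʳ n))) (ℕ.*-comm 2 n))

  -- At an even index n both n(n - 1) and n - 2 are even, whatever the parity of the preceding Δ.
  d-even : ∀ k → 2 ℕ.∣ d (k ℕ.+ k)
  d-even zero    = ℕ.divides 4 refl
  d-even (suc k) = subst (λ m → 2 ℕ.∣ d (suc m)) (sym (ℕ.+-suc k k))
    (ℕ.∣m∣n⇒∣m+n (ℕ.∣m⇒∣m*n (d (suc m)) (ℕ.∣m⇒∣m*n (5 ℕ.+ m) (ℕ.∣m∣n⇒∣m+n (ℕ.divides 3 refl) (2∣2n k))))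
                 (ℕ.∣m⇒∣m*n (q (5 ℕ.+ m)) (ℕ.∣m∣n⇒∣m+n (ℕ.divides 2 refl) (2∣2n k))))
    where m = k ℕ.+ k

  Δ-even : ∀ n → 1 ℕ.≤ n → IsEvenInteger (Δ (2 ℕ.* n))
  Δ-even 1 _ = -ℤ + 2 , Δ2 , ℕ.divides 1 refl
  Δ-even (suc (suc k)) _ = + d (k ℕ.+ k) , trans (cong Δ index) (Δ≡d (k ℕ.+ k)) , d-even k
    where
    index : 2 ℕ.* suc (suc k) ≡ 4 ℕ.+ (k ℕ.+ k)
    index = trans (cong (λ z → suc (suc (k ℕ.+ suc (suc z)))) (ℕ.+-identityʳ k))
      (cong (λ z → suc (suc z)) (trans (ℕ.+-suc k (suc k)) (cong suc (ℕ.+-suc k k))))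

  -- The common three-term recurrence and its identification with the continued fraction

  b′ : ℕ → ℚ
  b′ m = fromℕ (suc (suc m)) * fromℕ (suc (suc m)) * Δ (suc m) + fromℕ (suc m) * fromℕ m * ½ * fromℕ (q m)

  q-three-term : ∀ m → ½ * fromℕ (suc (suc m)) * Δ (suc m) * fromℕ (q (suc (suc m)))
    ≡ b′ m * fromℕ (q (suc m)) - ½ * fromℕ (suc m) * Δ (suc (suc m)) * fromℕ (q m)
  q-three-term m = begin
    ½ * N * D * fromℕ (q (suc (suc m)))
      ≡⟨ cong (½ * N * D *_) (q-rec m) ⟩
    ½ * N * D * ((N + N) * q₁ - M * M * q₀)
      ≡⟨ expand N M x D q₀ q₁ ⟩
    b′ m * q₁ - ½ * M * (N * M * D + x * q₁) * q₀
      ≡⟨ cong (λ z → b′ m * q₁ - ½ * M * z * q₀) (Δ-suc m) ⟨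
    b′ m * q₁ - ½ * M * Δ (suc (suc m)) * q₀ ∎
    where
    open ≡-Reasoning
    N  = fromℕ (suc (suc m))
    M  = fromℕ (suc m)
    x  = fromℕ m
    D  = Δ (suc m)
    q₀ = fromℕ (q m)
    q₁ = fromℕ (q (suc m))
    expand : ∀ N M x D q₀ q₁ → ½ * N * D * ((N + N) * q₁ - M * M * q₀)
      ≡ (N * N * D + M * x * ½ * q₀) * q₁ - ½ * M * (N * M * D + x * q₁) * q₀
    expand = solve-∀ ℚ-ring

  -- By `Δ-det` the source of `p`, once multiplied by Δ (n - 1), is a combination of `p₀` and `p₁`
  -- with coefficients in `q`. These change the coefficients exactly as rewriting by `Δ-suc` does in
  -- `q-three-term`, so `p` and `q` share one homogeneous recurrence.
  p-three-term : ∀ m → ½ * fromℕ (suc (suc m)) * Δ (suc m) * p (suc (suc m))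
    ≡ b′ m * p (suc m) - ½ * fromℕ (suc m) * Δ (suc (suc m)) * p m
  p-three-term m = begin
    ½ * N * D * p (suc (suc m))
      ≡⟨ cong (½ * N * D *_) (p-rec m) ⟩
    ½ * N * D * ((N + N) * p₁ - M * M * p₀ - x * r)
      ≡⟨ separate N D ((N + N) * p₁ - M * M * p₀) x r ⟩
    ½ * N * D * ((N + N) * p₁ - M * M * p₀) - ½ * x * D * (N * r)
      ≡⟨ cong (λ z → ½ * N * D * ((N + N) * p₁ - M * M * p₀) - ½ * x * D * z) (n*1/n≡1 (suc m)) ⟩
    ½ * N * D * ((N + N) * p₁ - M * M * p₀) - ½ * x * D * 1ℚ
      ≡⟨ cong (λ z → ½ * N * D * ((N + N) * p₁ - M * M * p₀) - ½ * x * z * 1ℚ) (Δ-det m) ⟩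
    ½ * N * D * ((N + N) * p₁ - M * M * p₀) - ½ * x * (M * (p₀ * q₁ - p₁ * q₀)) * 1ℚ
      ≡⟨ expand N M x D p₀ p₁ q₀ q₁ ⟩
    b′ m * p₁ - ½ * M * (N * M * D + x * q₁) * p₀
      ≡⟨ cong (λ z → b′ m * p₁ - ½ * M * z * p₀) (Δ-suc m) ⟨
    b′ m * p₁ - ½ * M * Δ (suc (suc m)) * p₀ ∎
    where
    open ≡-Reasoning
    N  = fromℕ (suc (suc m))
    M  = fromℕ (suc m)
    x  = fromℕ m
    r  = + 1 / suc (suc m)
    D  = Δ (suc m)
    p₀ = p m
    p₁ = p (suc m)
    q₀ = fromℕ (q m)
    q₁ = fromℕ (q (suc m))
    separate : ∀ N D z x r → ½ * N * D * (z - x * r) ≡ ½ * N * D * z - ½ * x * D * (N * r)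
    separate = solve-∀ ℚ-ring
    expand : ∀ N M x D p₀ p₁ q₀ q₁ →
      ½ * N * D * ((N + N) * p₁ - M * M * p₀) - ½ * x * (M * (p₀ * q₁ - p₁ * q₀)) * 1ℚ
      ≡ (N * N * D + M * x * ½ * q₀) * p₁ - ½ * M * (N * M * D + x * q₁) * p₀
    expand = solve-∀ ℚ-ring

  -- The equivalence transformation making the leading coefficient ½ n Δ (n - 1) equal to 1. It
  -- multiplies ½ (n - 1) Δ n by ½ (n - 1) Δ (n - 2), whence the quarter in `a*`. The start 30 is
  -- fixed by the fourth denominator 6270 = 30 · 209 = 30 · `q 4`.
  scale : ℕ → ℚ
  scale zero    = fromℕ 30
  scale (suc m) = scale m * (½ * fromℕ (5 ℕ.+ m) * Δ (4 ℕ.+ m))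

  scale-pos : ∀ m → Positive (scale m)
  scale-pos zero    = _
  scale-pos (suc m) = pos*pos⇒pos (scale m) {{scale-pos m}} _ {{pos*pos⇒pos (½ * N) {{pos*pos⇒pos ½ N {{fromℕ-pos (5 ℕ.+ m)}}}}
    (Δ (4 ℕ.+ m)) {{Δ-positive (4 ℕ.+ m) (ℕ.m≤m+n 4 m)}}}}
    where N = fromℕ (5 ℕ.+ m)

  a*≡ : ∀ m → a* Δ (6 ℕ.+ m) ≡ - (½ * fromℕ (5 ℕ.+ m) * (½ * fromℕ (5 ℕ.+ m)) * Δ (6 ℕ.+ m) * Δ (4 ℕ.+ m))
  a*≡ m = cong (λ z → - (z * Δ (6 ℕ.+ m) * Δ (4 ℕ.+ m)))
    (trans (/-split ((5 ℕ.+ m) ℕ.^ 2) 3) (trans (cong (_* (½ * ½)) (fromℕ-^2 (5 ℕ.+ m))) (regroup (fromℕ (5 ℕ.+ m)))))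
    where
    regroup : ∀ x → x * x * (½ * ½) ≡ ½ * x * (½ * x)
    regroup = solve-∀ ℚ-ring

  b*≡ : ∀ m → b* Δ (6 ℕ.+ m) ≡ b′ (4 ℕ.+ m)
  b*≡ m = cong₂ (λ x y → x * Δ (5 ℕ.+ m) + y * fromℕ (q (4 ℕ.+ m))) (fromℕ-^2 (6 ℕ.+ m))
    (trans (/-split ((5 ℕ.+ m) ℕ.* (4 ℕ.+ m)) 1) (cong (_* ½) (fromℕ-* (5 ℕ.+ m) (4 ℕ.+ m))))

  scaled-step : ∀ m x₀ x₁ x₂ →
    ½ * fromℕ (6 ℕ.+ m) * Δ (5 ℕ.+ m) * x₂ ≡ b′ (4 ℕ.+ m) * x₁ - ½ * fromℕ (5 ℕ.+ m) * Δ (6 ℕ.+ m) * x₀ →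
    b* Δ (6 ℕ.+ m) * (scale (1 ℕ.+ m) * x₁) + a* Δ (6 ℕ.+ m) * (scale m * x₀) ≡ scale (2 ℕ.+ m) * x₂
  scaled-step m x₀ x₁ x₂ three-term = begin
    b* Δ (6 ℕ.+ m) * (s * (h * D) * x₁) + a* Δ (6 ℕ.+ m) * (s * x₀)
      ≡⟨ cong₂ (λ b a → b * (s * (h * D) * x₁) + a * (s * x₀)) (b*≡ m) (a*≡ m) ⟩
    B * (s * (h * D) * x₁) + - (h * h * E * D) * (s * x₀)
      ≡⟨ factor s h D B E x₀ x₁ ⟩
    s * (h * D) * (B * x₁ - h * E * x₀)
      ≡⟨ cong (s * (h * D) *_) three-term ⟨
    s * (h * D) * (½ * fromℕ (6 ℕ.+ m) * Δ (5 ℕ.+ m) * x₂)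
      ≡⟨ *-assoc (s * (h * D)) (½ * fromℕ (6 ℕ.+ m) * Δ (5 ℕ.+ m)) x₂ ⟨
    scale (2 ℕ.+ m) * x₂ ∎
    where
    open ≡-Reasoning
    s = scale m
    h = ½ * fromℕ (5 ℕ.+ m)
    D = Δ (4 ℕ.+ m)
    E = Δ (6 ℕ.+ m)
    B = b′ (4 ℕ.+ m)
    factor : ∀ s h D B E x₀ x₁ → B * (s * (h * D) * x₁) + - (h * h * E * D) * (s * x₀)
      ≡ s * (h * D) * (B * x₁ - h * E * x₀)
    factor = solve-∀ ℚ-ring

  -- Stated for an arbitrary solution, to serve numerators and denominators alike. `X` is shifted by
  -- one, so `X 5` is the fourth of them.
  recur≡scale : ∀ (x : ℕ → ℚ) x₋₁ x₀ → let X = recur (a* Δ) (b* Δ) x₋₁ x₀ in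
    X 5 ≡ fromℕ 30 * x 4 → X 6 ≡ fromℕ 600 * x 5 →
    (∀ m → ½ * fromℕ (2 ℕ.+ m) * Δ (1 ℕ.+ m) * x (2 ℕ.+ m)
           ≡ b′ m * x (1 ℕ.+ m) - ½ * fromℕ (1 ℕ.+ m) * Δ (2 ℕ.+ m) * x m) →
    ∀ m → X (5 ℕ.+ m) ≡ scale m * x (4 ℕ.+ m)
  recur≡scale x x₋₁ x₀ X₅ X₆ three-term m = proj₁ (both m)
    where
    X = recur (a* Δ) (b* Δ) x₋₁ x₀
    both : ∀ m → X (5 ℕ.+ m) ≡ scale m * x (4 ℕ.+ m) × X (6 ℕ.+ m) ≡ scale (1 ℕ.+ m) * x (5 ℕ.+ m)
    -- The constant 600 is 30 · ½ · 5 · Δ 4.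
    both zero = X₅ , trans X₆ (cong (λ z → fromℕ 30 * (½ * fromℕ 5 * z) * x 5) (sym Δ4))
    both (suc m) = proj₂ (both m) ,
      trans (cong₂ (λ y z → b* Δ (6 ℕ.+ m) * y + a* Δ (6 ℕ.+ m) * z) (proj₂ (both m)) (proj₁ (both m)))
            (scaled-step m _ _ _ (three-term (4 ℕ.+ m)))

  numerator≡ : ∀ m → numerator (a* Δ) (b* Δ) (4 ℕ.+ m) ≡ scale m * p (4 ℕ.+ m)
  -- The two `refl` evaluate the five exceptional partial quotients.
  numerator≡ = recur≡scale p 1ℚ 0ℚ refl refl p-three-term

  denominator≡ : ∀ m → denominator (a* Δ) (b* Δ) (4 ℕ.+ m) ≡ scale m * fromℕ (q (4 ℕ.+ m))
  denominator≡ = recur≡scale (λ n → fromℕ (q n)) 0ℚ 1ℚ refl refl q-three-term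

-- Convergence

0≤-difference : ∀ {x y} → x ≤ y → 0ℚ ≤ y - x
0≤-difference {x} {y} x≤y = subst (_≤ y - x) (+-inverseʳ x) (+-monoˡ-≤ (- x) x≤y)

≤-from-difference : ∀ {x y z} → 0ℚ ≤ z → z ≡ y - x → x ≤ y
≤-from-difference {x} {y} {z} 0≤z eq = subst₂ _≤_ (+-identityˡ x)
  (trans (cong (_+ x) eq) (cancel y x)) (+-monoˡ-≤ x 0≤z)
  where
  cancel : ∀ y x → y - x + x ≡ y
  cancel = solve-∀ ℚ-ring

≤-same-difference : ∀ {x y x′ y′} → x ≤ y → y - x ≡ y′ - x′ → x′ ≤ y′
≤-same-difference x≤y eq = ≤-from-difference (0≤-difference x≤y) eq

0≤* : ∀ {x y} → 0ℚ ≤ x → 0ℚ ≤ y → 0ℚ ≤ x * y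
0≤* {x} {y} 0≤x 0≤y = nonNegative⁻¹ (x * y)
  {{nonNeg*nonNeg⇒nonNeg x {{nonNegative 0≤x}} y {{nonNegative 0≤y}}}}

0≤+ : ∀ {x y} → 0ℚ ≤ x → 0ℚ ≤ y → 0ℚ ≤ x + y
0≤+ 0≤x 0≤y = +-mono-≤ 0≤x 0≤y

0≤x² : ∀ x → 0ℚ ≤ x * x
0≤x² x with ≤-total 0ℚ x
... | inj₁ 0≤x = 0≤* 0≤x 0≤x
... | inj₂ x≤0 = subst (0ℚ ≤_) (square x) (0≤* 0≤-x 0≤-x)
  where
  square : ∀ x → (0ℚ - x) * (0ℚ - x) ≡ x * x
  square = solve-∀ ℚ-ring
  0≤-x = 0≤-difference x≤0

*-monoˡ : ∀ {c x y} → 0ℚ ≤ c → x ≤ y → c * x ≤ c * y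
*-monoˡ {c} 0≤c = *-monoˡ-≤-nonNeg c {{nonNegative 0≤c}}

ι : ℕ → ℚ
ι n = + 1 / suc n

0≤fromℕ : ∀ n → 0ℚ ≤ fromℕ n
0≤fromℕ n = nonNegative⁻¹ _ {{normalize-nonNeg n 1}}

0≤ι : ∀ n → 0ℚ ≤ ι n
0≤ι n = <⇒≤ (positive⁻¹ _ {{1/-pos n}})

ι≤1 : ∀ n → ι n ≤ 1ℚ
ι≤1 n = 1/-antimono {0} {n} ℕ.z≤n

[1+n]*ιn≡1 : ∀ n → (1ℚ + fromℕ n) * ι n ≡ 1ℚ
[1+n]*ιn≡1 n = trans (cong (_* ι n) (sym (fromℕ-suc n))) (n*1/n≡1 n)

-- log x ≤ x − 1, in terms of harmonic numbers.
H-≤ : ∀ x y → H x ≤ H (suc y) + (fromℕ x * ι y - 1ℚ)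
H-≤ x y with ℕ.≤-total (suc y) x
... | inj₁ sy≤x = subst (λ x → H x ≤ H (suc y) + (fromℕ x * ι y - 1ℚ)) (ℕ.m+[n∸m]≡n sy≤x) (begin
  H (suc y ℕ.+ d)                                       ≡⟨ H-split (suc y) d ⟩
  H (suc y) + ∑< d (λ i → ι (suc y ℕ.+ i))              ≤⟨ +-monoʳ-≤ (H (suc y)) (∑<-mono d λ i _ →
                                                             1/-antimono (ℕ.≤-trans (ℕ.n≤1+n y) (ℕ.m≤m+n (suc y) i))) ⟩
  H (suc y) + ∑< d (λ _ → ι y)                          ≡⟨ cong (λ z → H (suc y) + z) (∑<-const d (ι y)) ⟩
  H (suc y) + D * ι y                                   ≡⟨ cong (λ z → H (suc y) + z) (cancel D (ι y)) ⟩
  H (suc y) + (D * ι y + 1ℚ - 1ℚ)                       ≡⟨ cong (λ z → H (suc y) + (D * ι y + z - 1ℚ)) (n*1/n≡1 y) ⟨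
  H (suc y) + (D * ι y + fromℕ (suc y) * ι y - 1ℚ)      ≡⟨ cong (λ z → H (suc y) + (z - 1ℚ)) (collect D (fromℕ (suc y)) (ι y)) ⟩
  H (suc y) + ((fromℕ (suc y) + D) * ι y - 1ℚ)          ≡⟨ cong (λ z → H (suc y) + (z * ι y - 1ℚ)) (fromℕ-+ (suc y) d) ⟨
  H (suc y) + (fromℕ (suc y ℕ.+ d) * ι y - 1ℚ)          ∎)
  where
  open ≤-Reasoning
  d = x ℕ.∸ suc y
  D = fromℕ d
  cancel : ∀ D r → D * r ≡ D * r + 1ℚ - 1ℚ
  cancel = solve-∀ ℚ-ring
  collect : ∀ D y r → D * r + y * r ≡ (y + D) * r
  collect = solve-∀ ℚ-ring
... | inj₂ x≤sy = ≤-same-difference below (trans (shift (H x) (H (suc y)) D (ι y))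
    (cong (λ z → H (suc y) + (fromℕ x * ι y - z) - H x) total))
  where
  open ≤-Reasoning
  d = suc y ℕ.∸ x
  D = fromℕ d
  below : H x + D * ι y ≤ H (suc y)
  below = begin
    H x + D * ι y                       ≡⟨ cong (λ z → H x + z) (∑<-const d (ι y)) ⟨
    H x + ∑< d (λ _ → ι y)              ≤⟨ +-monoʳ-≤ (H x) (∑<-mono d λ i i<d → 1/-antimono
                                             (ℕ.s≤s⁻¹ (subst₂ ℕ._≤_ (ℕ.+-suc x i) (ℕ.m+[n∸m]≡n x≤sy) (ℕ.+-monoʳ-≤ x i<d)))) ⟩
    H x + ∑< d (λ i → ι (x ℕ.+ i))      ≡⟨ H-split x d ⟨
    H (x ℕ.+ d)                         ≡⟨ cong H (ℕ.m+[n∸m]≡n x≤sy) ⟩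
    H (suc y)                           ∎
  total : (fromℕ x + D) * ι y ≡ 1ℚ
  total = trans (cong (_* ι y) (trans (sym (fromℕ-+ x d)) (cong fromℕ (ℕ.m+[n∸m]≡n x≤sy)))) (n*1/n≡1 y)
  shift′ : ∀ h h′ D r X → h′ - (h + D * r) ≡ h′ + (X * r - (X + D) * r) - h
  shift′ = solve-∀ ℚ-ring
  shift : ∀ h h′ D r → h′ - (h + D * r) ≡ h′ + (fromℕ x * r - (fromℕ x + D) * r) - h
  shift h h′ D r = shift′ h h′ D r (fromℕ x)

-- Comparison of 2 H j - H i with H - log at a fixed mesh

term : ℕ → ℕ → ℚ
term j i = H j + H j - H i

module _ (k : ℕ) where

  private
    K = suc k
    ℓ : ℕ → ℚ
    ℓ n = logSum (suc n) k
    κ = ι k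
    -- refined j + 1 = (j + 1) K
    refined : ℕ → ℕ
    refined j = k ℕ.+ j ℕ.* K

  ι-refined : ∀ j i → fromℕ (suc j ℕ.* K) * ι (refined i) ≡ fromℕ (suc j) * ι i
  ι-refined j i = trans (cong (_* ι (refined i)) (fromℕ-* (suc j) K))
    (trans (*-assoc (fromℕ (suc j)) (fromℕ K) _)
      (cong (fromℕ (suc j) *_) (n*1/[m*n]≡1/m k i (refined i) refl)))

  -- log a² = log a + log a is exact for Riemann sums only if the second logarithm is taken with the
  -- mesh refined by the factor a = j + 1. The sum is then log a² at the original mesh.
  log-square : ∀ j → ℓ j + logSum (suc j) (refined j) ≡ H (suc j ℕ.* (suc j ℕ.* K)) - H K
  log-square j = begin
    ℓ j + logSum (suc j) (refined j)
      ≡⟨ cong₂ _+_ (logSum-difference j k) (logSum-difference j (refined j)) ⟨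
    H (suc j ℕ.* K) - H K + (H (suc j ℕ.* (suc j ℕ.* K)) - H (suc j ℕ.* K))
      ≡⟨ telescope (H (suc j ℕ.* K)) (H K) (H (suc j ℕ.* (suc j ℕ.* K))) ⟩
    H (suc j ℕ.* (suc j ℕ.* K)) - H K ∎
    where
    open ≡-Reasoning
    telescope : ∀ x y z → x - y + (z - x) ≡ z - y
    telescope = solve-∀ ℚ-ring

  -- `H-≤` at a²K and bK, where a = j + 1 and b = i + 1; the mesh factor K cancels in the quotient.
  -- `log-≥` exchanges the two arguments.
  log-≤ : ∀ j i → ℓ j + logSum (suc j) (refined j) - ℓ i ≤ fromℕ (suc j) * fromℕ (suc j) * ι i - 1ℚ
  log-≤ j i = begin
    ℓ j + logSum (suc j) (refined j) - ℓ i
      ≡⟨ cong₂ _-_ (log-square j) (sym (logSum-difference i k)) ⟩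
    H (suc j ℕ.* (suc j ℕ.* K)) - H K - (H (suc i ℕ.* K) - H K)
      ≤⟨ ≤-same-difference (H-≤ (suc j ℕ.* (suc j ℕ.* K)) (refined i)) (regroup (H (suc j ℕ.* (suc j ℕ.* K))) (H (suc i ℕ.* K)) (H K) (fromℕ (suc j ℕ.* (suc j ℕ.* K)) * ι (refined i))) ⟩
    fromℕ (suc j ℕ.* (suc j ℕ.* K)) * ι (refined i) - 1ℚ
      ≡⟨ cong (_- 1ℚ) (trans (cong (_* ι (refined i)) (fromℕ-* (suc j) (suc j ℕ.* K)))
          (trans (*-assoc (fromℕ (suc j)) _ _) (trans (cong (fromℕ (suc j) *_) (ι-refined j i)) (sym (*-assoc (fromℕ (suc j)) _ _))))) ⟩
    fromℕ (suc j) * fromℕ (suc j) * ι i - 1ℚ ∎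
    where
    open ≤-Reasoning
    regroup : ∀ x y h e → y + (e - 1ℚ) - x ≡ e - 1ℚ - (x - h - (y - h))
    regroup = solve-∀ ℚ-ring

  log-≥ : ∀ j i → ℓ i - (ℓ j + logSum (suc j) (refined j)) ≤ fromℕ (suc i) * (ι j * ι j) - 1ℚ
  log-≥ j i = begin
    ℓ i - (ℓ j + logSum (suc j) (refined j))
      ≡⟨ cong₂ _-_ (sym (logSum-difference i k)) (log-square j) ⟩
    H (suc i ℕ.* K) - H K - (H (suc j ℕ.* (suc j ℕ.* K)) - H K)
      ≤⟨ ≤-same-difference (H-≤ (suc i ℕ.* K) J²K) (regroup (H (suc i ℕ.* K)) (H (suc j ℕ.* (suc j ℕ.* K))) (H K) (fromℕ (suc i ℕ.* K) * ι J²K)) ⟩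
    fromℕ (suc i ℕ.* K) * ι J²K - 1ℚ
      ≡⟨ cong (_- 1ℚ) (begin-equality
          fromℕ (suc i ℕ.* K) * ι J²K                          ≡⟨ *-identityʳ _ ⟨
          fromℕ (suc i ℕ.* K) * ι J²K * 1ℚ                     ≡⟨ cong (fromℕ (suc i ℕ.* K) * ι J²K *_) (n*1/n≡1 j) ⟨
          fromℕ (suc i ℕ.* K) * ι J²K * (M * ι j)              ≡⟨ cong (λ z → z * ι J²K * (M * ι j)) (fromℕ-* (suc i) K) ⟩
          fromℕ (suc i) * fromℕ K * ι J²K * (M * ι j)          ≡⟨ gather (fromℕ (suc i)) (fromℕ K) (ι J²K) M (ι j) ⟩
          fromℕ (suc i) * (M * fromℕ K * ι J²K * ι j)          ≡⟨ cong (λ z → fromℕ (suc i) * (z * ι J²K * ι j)) (fromℕ-* (suc j) K) ⟨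
          fromℕ (suc i) * (fromℕ (suc j ℕ.* K) * ι J²K * ι j)  ≡⟨ cong (λ z → fromℕ (suc i) * (z * ι j)) (n*1/[m*n]≡1/m (refined j) j J²K refl) ⟩
          fromℕ (suc i) * (ι j * ι j)                          ∎) ⟩
    fromℕ (suc i) * (ι j * ι j) - 1ℚ ∎
    where
    open ≤-Reasoning
    J²K = refined j ℕ.+ j ℕ.* (suc j ℕ.* K)
    M = fromℕ (suc j)
    regroup : ∀ x y h e → y + (e - 1ℚ) - x ≡ e - 1ℚ - (x - h - (y - h))
    regroup = solve-∀ ℚ-ring
    gather : ∀ i K r j s → i * K * r * (j * s) ≡ i * (j * K * r * s)
    gather = solve-∀ ℚ-ring

  k≤refined : ∀ j → k ℕ.≤ refined j
  k≤refined j = ℕ.m≤m+n k (j ℕ.* K)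

  ℓ≤ : ∀ j → ℓ j ≤ logSum (suc j) (refined j) + κ
  ℓ≤ j = ≤-trans (logSum-compare j k (refined j)) (+-monoʳ-≤ (logSum (suc j) (refined j)) (1/-antimono (k≤refined j)))

  E : ℕ → ℚ
  E n = approx (H-log n) k

  -- The correction `ι n` appears because `E n` is built on `H (suc n)`.
  H≡ : ∀ n → H n ≡ E n + ℓ n - ι n
  H≡ n = cancel (H n) (ι n) (ℓ n)
    where
    cancel : ∀ h r l → h ≡ h + r - l + l - r
    cancel = solve-∀ ℚ-ring

  -- The two losses `ι j` from `slow` cancel the corrections of `H≡`, leaving only `ι i`. One of the
  -- two copies of `ℓ j` is moved to the refined mesh of `log-square`, which costs `κ`.
  term-upper : ∀ j i → term j i - E (j ℕ.+ i) ≤ ι i + fromℕ (suc j) * fromℕ (suc j) * ι i - 1ℚ + κ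
  term-upper j i = ≤-same-difference
    (+-mono-≤ (+-mono-≤ slow slow) (+-mono-≤ decreasing (+-mono-≤ (ℓ≤ j) (log-≤ j i))))
    (trans (regroup (E j) (E i) (E (j ℕ.+ i)) (ℓ j) (ℓ i) ℓ′ (ι j) (ι i) κ _)
      (cong₂ (λ x y → z - 1ℚ + κ - (x + x - y - E (j ℕ.+ i))) (sym (H≡ j)) (sym (H≡ i))))
    where
    ℓ′ = logSum (suc j) (refined j)
    z = ι i + fromℕ (suc j) * fromℕ (suc j) * ι i
    slow : E j ≤ E (j ℕ.+ i) + ι j
    slow = H-log-slow j i k
    decreasing : E (j ℕ.+ i) ≤ E i
    decreasing = subst (λ n → E n ≤ E i) (ℕ.+-comm i j) (H-log-decreasing i j k)
    regroup : ∀ Ej Ei En ℓj ℓi ℓ′ a b κ z →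
      En + a + (En + a) + (Ei + (ℓ′ + κ + (z - 1ℚ))) - (Ej + Ej + (En + (ℓj + (ℓj + ℓ′ - ℓi))))
      ≡ b + z - 1ℚ + κ - (Ej + ℓj - a + (Ej + ℓj - a) - (Ei + ℓi - b) - En)
    regroup = solve-∀ ℚ-ring

  -- Monotonicity is applied the other way round: now the loss `ι i` is cancelled by `H≡` and 2
  -- `ι j` remains.
  term-lower : ∀ j i → E (j ℕ.+ i) - term j i ≤ ι j + ι j + fromℕ (suc i) * (ι j * ι j) - 1ℚ + κ
  term-lower j i = ≤-same-difference
    (+-mono-≤ (+-mono-≤ decreasing decreasing) (+-mono-≤ slow (+-mono-≤ (logSum-compare j (refined j) k) (log-≥ j i))))
    (trans (regroup (E j) (E i) (E (j ℕ.+ i)) (ℓ j) (ℓ i) ℓ′ (ι j) (ι i) κ _)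
      (cong₂ (λ x y → z - 1ℚ + κ - (E (j ℕ.+ i) - (x + x - y))) (sym (H≡ j)) (sym (H≡ i))))
    where
    ℓ′ = logSum (suc j) (refined j)
    z = ι j + ι j + fromℕ (suc i) * (ι j * ι j)
    decreasing : E (j ℕ.+ i) ≤ E j
    decreasing = H-log-decreasing j i k
    slow : E i ≤ E (j ℕ.+ i) + ι i
    slow = subst (λ n → E i ≤ E n + ι i) (ℕ.+-comm i j) (H-log-slow i j k)
    regroup : ∀ Ej Ei En ℓj ℓi ℓ′ a b κ z →
      Ej + Ej + (En + b + (ℓj + κ + (z - 1ℚ))) - (En + En + (Ei + (ℓ′ + (ℓi - (ℓj + ℓ′)))))
      ≡ a + a + z - 1ℚ + κ - (En - (Ej + ℓj - a + (Ej + ℓj - a) - (Ei + ℓi - b)))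
    regroup = solve-∀ ℚ-ring

-- Averages over the antidiagonal

β-pos : ∀ i → Positive (β i)
β-pos zero    = _
β-pos (suc i) = pos*pos⇒pos (β i) {{β-pos i}} (ι i) {{1/-pos i}}

α-pos : ∀ j → Positive (α j)
α-pos j = pos*pos⇒pos (β j) {{β-pos j}} (β j) {{β-pos j}}

αβ-pos : ∀ j i → Positive (α j * β i)
αβ-pos j i = pos*pos⇒pos (α j) {{α-pos j}} (β i) {{β-pos i}}

0≤αβ : ∀ j i → 0ℚ ≤ α j * β i
0≤αβ j i = <⇒≤ (positive⁻¹ _ {{αβ-pos j i}})

mass : ℕ → ℚ
mass = conv α β

⟨_⟩ : (ℕ → ℕ → ℚ) → ℕ → ℚ
⟨ f ⟩ n = ∑↗ n λ j i → α j * β i * f j i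

-- A bound on the weighted average, multiplied by the total mass so that no division occurs.
record Mean≤ (n : ℕ) (f : ℕ → ℕ → ℚ) (c : ℚ) : Set where
  constructor mean≤
  field bound : ⟨ f ⟩ n ≤ c * mass n

open Mean≤

mean-mono : ∀ {n f g c} → (∀ j i → j ℕ.+ i ≡ n → f j i ≤ g j i) → Mean≤ n g c → Mean≤ n f c
mean-mono {n} h (mean≤ b) = mean≤ (≤-trans (∑↗-mono n λ j i eq → *-monoˡ (0≤αβ j i) (h j i eq)) b)

mean-const : ∀ {n} c → Mean≤ n (λ _ _ → c) c
mean-const {n} c = mean≤ (≤-reflexive
  (trans (∑↗-cong n λ j i _ → *-comm (α j * β i) c) (∑↗-*ˡ n c _)))

mean-+ : ∀ {n f g c d} → Mean≤ n f c → Mean≤ n g d → Mean≤ n (λ j i → f j i + g j i) (c + d)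
mean-+ {n} {f} {g} {c} {d} (mean≤ f≤) (mean≤ g≤) = mean≤ (begin
  ⟨ (λ j i → f j i + g j i) ⟩ n    ≡⟨ ∑↗-cong n (λ j i _ → *-distribˡ-+ (α j * β i) (f j i) (g j i)) ⟩
  _                                ≡⟨ ∑↗-+ n _ _ ⟩
  ⟨ f ⟩ n + ⟨ g ⟩ n                ≤⟨ +-mono-≤ f≤ g≤ ⟩
  c * mass n + d * mass n          ≡⟨ *-distribʳ-+ (mass n) c d ⟨
  (c + d) * mass n                 ∎)
  where open ≤-Reasoning

mean-*ˡ : ∀ {n f c r} → 0ℚ ≤ r → Mean≤ n f c → Mean≤ n (λ j i → r * f j i) (r * c)
mean-*ˡ {n} {f} {c} {r} 0≤r (mean≤ f≤) = mean≤ (begin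
  ⟨ (λ j i → r * f j i) ⟩ n    ≡⟨ ∑↗-cong n (λ j i _ → swap (α j * β i) r (f j i)) ⟩
  _                            ≡⟨ ∑↗-*ˡ n r _ ⟩
  r * ⟨ f ⟩ n                  ≤⟨ *-monoˡ 0≤r f≤ ⟩
  r * (c * mass n)             ≡⟨ *-assoc r c (mass n) ⟨
  r * c * mass n               ∎)
  where
  open ≤-Reasoning
  swap : ∀ w c x → w * (c * x) ≡ c * (w * x)
  swap = solve-∀ ℚ-ring

mass-pos : ∀ n → 0ℚ < mass n
mass-pos zero    = positive⁻¹ _
mass-pos (suc n) = +-mono-<-≤ (positive⁻¹ (α 0 * β (suc n)) {{αβ-pos 0 (suc n)}})
  (≤-trans (≤-reflexive (sym (trans (∑↗-*ˡ n 0ℚ _) (*-zeroˡ (mass n)))))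
    (∑↗-mono n {λ j i → 0ℚ * (α j * β i)} λ j i _ → ≤-trans (≤-reflexive (*-zeroˡ (α j * β i))) (0≤αβ (suc j) i)))

-- The next two bounds come from the ratio i : (j + 1)² of the weights at
-- (j , i) and (j + 1 , i − 1).
⟨j²/[1+i]⟩≤ : ∀ n → Mean≤ n (λ j i → fromℕ j * fromℕ j * ι i) 1ℚ
⟨j²/[1+i]⟩≤ zero    = mean≤ (≤-trans (≤-reflexive refl) (0≤* (0≤ι 0) (<⇒≤ (mass-pos 0))))
⟨j²/[1+i]⟩≤ (suc n) = mean≤ (begin
  α 0 * β (suc n) * (0ℚ * 0ℚ * ι (suc n)) + ∑↗ n (λ j i → α (suc j) * β i * (fromℕ (suc j) * fromℕ (suc j) * ι i))
    ≡⟨ zeros (α 0 * β (suc n)) (ι (suc n)) _ ⟩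
  ∑↗ n (λ j i → α (suc j) * β i * (fromℕ (suc j) * fromℕ (suc j) * ι i))
    ≡⟨ ∑↗-cong n (λ j i _ → trans (regroup (α (suc j)) (β i) (fromℕ (suc j)) (ι i)) (cong (_* β (suc i)) (θθα-suc j))) ⟩
  ∑↗ n (λ j i → α j * β (suc i))
    ≤⟨ ≤-same-difference (0≤αβ (suc n) 0) (difference (∑↗ n (λ j i → α j * β (suc i))) (α (suc n) * β 0)) ⟩
  1ℚ * (∑↗ n (λ j i → α j * β (suc i)) + α (suc n) * β 0)
    ≡⟨ cong (1ℚ *_) (conv-sucʳ n α β) ⟨
  1ℚ * mass (suc n) ∎)
  where
  open ≤-Reasoning
  zeros : ∀ x y z → x * (0ℚ * 0ℚ * y) + z ≡ z
  zeros = solve-∀ ℚ-ring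
  regroup : ∀ a b n r → a * b * (n * n * r) ≡ n * (n * a) * (b * r)
  regroup = solve-∀ ℚ-ring
  difference : ∀ x y → y - 0ℚ ≡ 1ℚ * (x + y) - x
  difference = solve-∀ ℚ-ring

⟨i/[1+j]²⟩≤ : ∀ n → Mean≤ n (λ j i → fromℕ i * (ι j * ι j)) 1ℚ
⟨i/[1+j]²⟩≤ zero    = mean≤ (≤-trans (≤-reflexive refl) (0≤* (0≤ι 0) (<⇒≤ (mass-pos 0))))
⟨i/[1+j]²⟩≤ (suc n) = mean≤ (begin
  ⟨ (λ j i → fromℕ i * (ι j * ι j)) ⟩ (suc n)
    ≡⟨ ∑↗-peelʳ n (λ j i → α j * β i * (fromℕ i * (ι j * ι j))) ⟩
  ∑↗ n (λ j i → α j * β (suc i) * (fromℕ (suc i) * (ι j * ι j))) + α (suc n) * β 0 * (0ℚ * (ι (suc n) * ι (suc n)))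
    ≡⟨ zeros (α (suc n) * β 0) (ι (suc n) * ι (suc n)) _ ⟩
  ∑↗ n (λ j i → α j * β (suc i) * (fromℕ (suc i) * (ι j * ι j)))
    ≡⟨ ∑↗-cong n (λ j i _ → trans (regroup (β j) (β (suc i)) (fromℕ (suc i)) (ι j)) (cong (α (suc j) *_) (θβ-suc i))) ⟩
  ∑↗ n (λ j i → α (suc j) * β i)
    ≤⟨ ≤-same-difference (0≤αβ 0 (suc n)) (difference (∑↗ n (λ j i → α (suc j) * β i)) (α 0 * β (suc n))) ⟩
  1ℚ * mass (suc n) ∎)
  where
  open ≤-Reasoning
  zeros : ∀ x y z → z + x * (0ℚ * y) ≡ z
  zeros = solve-∀ ℚ-ring
  regroup : ∀ b c n r → b * b * c * (n * (r * r)) ≡ b * r * (b * r) * (n * c)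
  regroup = solve-∀ ℚ-ring
  difference : ∀ x y → y - 0ℚ ≡ 1ℚ * (y + x) - x
  difference = solve-∀ ℚ-ring

[1+j]²/[1+i] 1/[1+i] 1/[1+j]² : ℕ → ℕ → ℚ
[1+j]²/[1+i] j i = (1ℚ + fromℕ j) * (1ℚ + fromℕ j) * ι i
1/[1+i] j i = ι i
1/[1+j]² j i = ι j * ι j

-- (1 + j)² ≤ 2j² + 2 and 1/(1 + i) ≤ 1 give 2 · 1 + 2 = 4.
⟨[1+j]²/[1+i]⟩≤ : ∀ n → Mean≤ n [1+j]²/[1+i] (fromℕ 4)
⟨[1+j]²/[1+i]⟩≤ n = mean-mono
  (λ j i _ → ≤-from-difference
    (0≤+ (0≤* (0≤ι i) (0≤x² (1ℚ - fromℕ j))) (0≤+ (0≤-difference (ι≤1 i)) (0≤-difference (ι≤1 i))))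
    (difference (fromℕ j) (ι i)))
  (mean-+ (mean-*ˡ (0≤fromℕ 2) (⟨j²/[1+i]⟩≤ n)) (mean-const (fromℕ 2)))
  where
  difference : ∀ x b → b * ((1ℚ - x) * (1ℚ - x)) + (1ℚ - b + (1ℚ - b))
               ≡ fromℕ 2 * (x * x * b) + fromℕ 2 - (1ℚ + x) * (1ℚ + x) * b
  difference = solve-∀ ℚ-ring

[2+j+i]*ι≡1 : ∀ j i → (1ℚ + fromℕ j + (1ℚ + fromℕ i)) * ι (suc (j ℕ.+ i)) ≡ 1ℚ
[2+j+i]*ι≡1 j i = trans (cong (_* ι (suc (j ℕ.+ i))) (begin
  1ℚ + fromℕ j + (1ℚ + fromℕ i)   ≡⟨ regroup (fromℕ j) (fromℕ i) ⟩
  1ℚ + (1ℚ + (fromℕ j + fromℕ i)) ≡⟨ cong (λ z → 1ℚ + (1ℚ + z)) (fromℕ-+ j i) ⟨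
  1ℚ + (1ℚ + fromℕ (j ℕ.+ i))     ≡⟨ cong (λ z → 1ℚ + z) (fromℕ-suc (j ℕ.+ i)) ⟨
  1ℚ + fromℕ (suc (j ℕ.+ i))      ∎)) ([1+n]*ιn≡1 (suc (j ℕ.+ i)))
  where
  open ≡-Reasoning
  regroup : ∀ x y → 1ℚ + x + (1ℚ + y) ≡ 1ℚ + (1ℚ + (x + y))
  regroup = solve-∀ ℚ-ring

-- 1 = (a + b) / (n + 2) with a = j + 1 and b = i + 1 turns the bound on
-- a² / b into one on 1 / b.
⟨1/[1+i]⟩≤ : ∀ n → Mean≤ n 1/[1+i] (ι (suc n) * fromℕ 5)
⟨1/[1+i]⟩≤ n = mean-mono (λ { j i refl → pointwise j i })
  (mean-*ˡ (0≤ι (suc n)) (mean-+ (⟨[1+j]²/[1+i]⟩≤ n) (mean-const 1ℚ)))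
  where
  pointwise : ∀ j i → ι i ≤ ι (suc (j ℕ.+ i)) * ([1+j]²/[1+i] j i + 1ℚ)
  pointwise j i = ≤-from-difference
    (0≤* (0≤* (0≤ι (suc (j ℕ.+ i))) (0≤ι i)) (0≤* (0≤+ (0≤fromℕ 1) (0≤fromℕ j)) (0≤fromℕ j)))
    (begin
      r * b * ((1ℚ + x) * x)
        ≡⟨ expand r b x y ⟩
      r * ((1ℚ + x) * (1ℚ + x) * b + (1ℚ + y) * b) - b * ((1ℚ + x + (1ℚ + y)) * r)
        ≡⟨ cong₂ (λ u v → r * ((1ℚ + x) * (1ℚ + x) * b + u) - b * v) ([1+n]*ιn≡1 i) ([2+j+i]*ι≡1 j i) ⟩
      r * ((1ℚ + x) * (1ℚ + x) * b + 1ℚ) - b * 1ℚ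
        ≡⟨ cong (λ z → r * ((1ℚ + x) * (1ℚ + x) * b + 1ℚ) - z) (*-identityʳ b) ⟩
      r * ((1ℚ + x) * (1ℚ + x) * b + 1ℚ) - b ∎)
    where
    open ≡-Reasoning
    r = ι (suc (j ℕ.+ i))
    b = ι i
    x = fromℕ j
    y = fromℕ i
    expand : ∀ r b x y → r * b * ((1ℚ + x) * x) ≡ r * ((1ℚ + x) * (1ℚ + x) * b + (1ℚ + y) * b) - b * ((1ℚ + x + (1ℚ + y)) * r)
    expand = solve-∀ ℚ-ring

-- Multiplying 1/a² by (a + b)/(n + 2) gives (1/a + 1/a² + i/a²)/(n + 2), in which the first two
-- terms are at most 1 and the last has mean at most 1.
⟨1/[1+j]²⟩≤ : ∀ n → Mean≤ n 1/[1+j]² (ι (suc n) * fromℕ 3)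
⟨1/[1+j]²⟩≤ n = mean-mono (λ { j i refl → pointwise j i })
  (mean-*ˡ (0≤ι (suc n)) (mean-+ (⟨i/[1+j]²⟩≤ n) (mean-const (fromℕ 2))))
  where
  pointwise : ∀ j i → ι j * ι j ≤ ι (suc (j ℕ.+ i)) * (fromℕ i * (ι j * ι j) + fromℕ 2)
  pointwise j i = ≤-from-difference
    (0≤* (0≤ι (suc (j ℕ.+ i))) (0≤+ (0≤-difference (ι≤1 j)) (0≤-difference a²≤1)))
    (begin
      r * (1ℚ - a + (1ℚ - a * a))
        ≡⟨ cong (λ z → r * (1ℚ - z + (1ℚ - a * a))) (trans (sym (*-identityˡ a)) (cong (_* a) (sym ([1+n]*ιn≡1 j)))) ⟩
      r * (1ℚ - (1ℚ + x) * a * a + (1ℚ - a * a))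
        ≡⟨ expand r a x y ⟩
      r * (y * (a * a) + fromℕ 2) - a * a * ((1ℚ + x + (1ℚ + y)) * r)
        ≡⟨ cong (λ z → r * (y * (a * a) + fromℕ 2) - a * a * z) ([2+j+i]*ι≡1 j i) ⟩
      r * (y * (a * a) + fromℕ 2) - a * a * 1ℚ
        ≡⟨ cong (λ z → r * (y * (a * a) + fromℕ 2) - z) (*-identityʳ (a * a)) ⟩
      r * (y * (a * a) + fromℕ 2) - a * a ∎)
    where
    open ≡-Reasoning
    r = ι (suc (j ℕ.+ i))
    a = ι j
    x = fromℕ j
    y = fromℕ i
    a²≤1 : a * a ≤ 1ℚ
    a²≤1 = ≤-trans (*-monoˡ (0≤ι j) (ι≤1 j)) (≤-trans (≤-reflexive (*-identityʳ a)) (ι≤1 j))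
    expand : ∀ r a x y → r * (1ℚ - (1ℚ + x) * a * a + (1ℚ - a * a))
             ≡ r * (y * (a * a) + fromℕ 2) - a * a * ((1ℚ + x + (1ℚ + y)) * r)
    expand = solve-∀ ℚ-ring

-- With s = t + 1 a free parameter, 2a ≤ a²/s + s and 2/a ≤ 1/s + s/a².
module _ (n k t : ℕ) where

  private
    s = 1ℚ + fromℕ t
    σ = ι t
    κ = ι k
    r = ι (suc n)
    sσ≡1 : s * σ ≡ 1ℚ
    sσ≡1 = [1+n]*ιn≡1 t
    0≤s : 0ℚ ≤ s
    0≤s = 0≤+ (0≤fromℕ 1) (0≤fromℕ t)

  -- Since a² + 1 = j² + 2a, the bound of `term-upper` is j²/b + 2a/b - 1 + `κ`. The mean of j²/b is
  -- at most 1 and offsets the -1; the excess 2a/b is split by `s` into a part small with 1/s and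
  -- one small with s/(n + 2).
  mean-upper : Mean≤ n (λ j i → term j i - E k n) (fromℕ 4 * σ + fromℕ 5 * (s * r) + κ)
  mean-upper = mean-mono (λ { j i refl → pointwise j i })
    (subst (Mean≤ n _) (collect σ s r κ) (mean-+ (⟨j²/[1+i]⟩≤ n)
      (mean-+ (mean-*ˡ (0≤ι t) (⟨[1+j]²/[1+i]⟩≤ n)) (mean-+ (mean-*ˡ 0≤s (⟨1/[1+i]⟩≤ n)) (mean-const (κ - 1ℚ))))))
    where
    collect : ∀ σ s r κ → 1ℚ + (σ * fromℕ 4 + (s * (r * fromℕ 5) + (κ - 1ℚ))) ≡ fromℕ 4 * σ + fromℕ 5 * (s * r) + κ
    collect = solve-∀ ℚ-ring
    pointwise : ∀ j i → term j i - E k (j ℕ.+ i) ≤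
      fromℕ j * fromℕ j * ι i + (σ * [1+j]²/[1+i] j i + (s * ι i + (κ - 1ℚ)))
    pointwise j i = ≤-trans (subst (λ z → term j i - E k (j ℕ.+ i) ≤ ι i + z * z * ι i - 1ℚ + κ) (fromℕ-suc j) (term-upper k j i))
      (≤-from-difference (0≤* (0≤* (0≤ι i) (0≤ι t)) (0≤x² (1ℚ + x - s))) (begin
        b * σ * ((1ℚ + x - s) * (1ℚ + x - s))
          ≡⟨ expand x b σ s κ ⟩
        x * x * b + (σ * ((1ℚ + x) * (1ℚ + x) * b) + (s * (s * σ) * b + (κ - 1ℚ)))
          - (b * (1ℚ + (x + x) * (s * σ) + (s * σ + s * σ) - 1ℚ) + x * x * b - 1ℚ + κ)
          ≡⟨ cong (λ z → x * x * b + (σ * ((1ℚ + x) * (1ℚ + x) * b) + (s * z * b + (κ - 1ℚ)))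
                         - (b * (1ℚ + (x + x) * z + (z + z) - 1ℚ) + x * x * b - 1ℚ + κ)) sσ≡1 ⟩
        x * x * b + (σ * ((1ℚ + x) * (1ℚ + x) * b) + (s * 1ℚ * b + (κ - 1ℚ)))
          - (b * (1ℚ + (x + x) * 1ℚ + (1ℚ + 1ℚ) - 1ℚ) + x * x * b - 1ℚ + κ)
          ≡⟨ tidy x b σ s κ ⟩
        x * x * b + (σ * ((1ℚ + x) * (1ℚ + x) * b) + (s * b + (κ - 1ℚ)))
          - (b + (1ℚ + x) * (1ℚ + x) * b - 1ℚ + κ) ∎))
      where
      open ≡-Reasoning
      x = fromℕ j
      b = ι i
      expand : ∀ x b σ s κ → b * σ * ((1ℚ + x - s) * (1ℚ + x - s)) ≡
        x * x * b + (σ * ((1ℚ + x) * (1ℚ + x) * b) + (s * (s * σ) * b + (κ - 1ℚ)))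
          - (b * (1ℚ + (x + x) * (s * σ) + (s * σ + s * σ) - 1ℚ) + x * x * b - 1ℚ + κ)
      expand = solve-∀ ℚ-ring
      tidy : ∀ x b σ s κ →
        x * x * b + (σ * ((1ℚ + x) * (1ℚ + x) * b) + (s * 1ℚ * b + (κ - 1ℚ)))
          - (b * (1ℚ + (x + x) * 1ℚ + (1ℚ + 1ℚ) - 1ℚ) + x * x * b - 1ℚ + κ)
        ≡ x * x * b + (σ * ((1ℚ + x) * (1ℚ + x) * b) + (s * b + (κ - 1ℚ)))
          - (b + (1ℚ + x) * (1ℚ + x) * b - 1ℚ + κ)
      tidy = solve-∀ ℚ-ring

  -- Here i/a² has mean at most 1 and offsets the -1. The excess is 1/a² + 2/a, of which 2/a is
  -- split by `s`.
  mean-lower : Mean≤ n (λ j i → E k n - term j i) (σ + fromℕ 3 * ((s + 1ℚ) * r) + κ)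
  mean-lower = mean-mono (λ { j i refl → pointwise j i })
    (subst (Mean≤ n _) (collect σ s r κ) (mean-+ (⟨i/[1+j]²⟩≤ n)
      (mean-+ (mean-*ˡ (0≤+ 0≤s (0≤fromℕ 1)) (⟨1/[1+j]²⟩≤ n)) (mean-const (σ + κ - 1ℚ)))))
    where
    collect : ∀ σ s r κ → 1ℚ + ((s + 1ℚ) * (r * fromℕ 3) + (σ + κ - 1ℚ)) ≡ σ + fromℕ 3 * ((s + 1ℚ) * r) + κ
    collect = solve-∀ ℚ-ring
    pointwise : ∀ j i → E k (j ℕ.+ i) - term j i ≤
      fromℕ i * (ι j * ι j) + ((s + 1ℚ) * 1/[1+j]² j i + (σ + κ - 1ℚ))
    pointwise j i = ≤-trans (subst (λ z → E k (j ℕ.+ i) - term j i ≤ ι j + ι j + z * (ι j * ι j) - 1ℚ + κ) (fromℕ-suc i) (term-lower k j i))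
      (≤-from-difference (0≤* (0≤ι t) (0≤x² (1ℚ - s * a))) (begin
        σ * ((1ℚ - s * a) * (1ℚ - s * a))
          ≡⟨ expand y a σ s κ ⟩
        y * (a * a) + (((s * σ) * s + 1ℚ) * (a * a) + (σ + κ - 1ℚ)) - ((s * σ) * (a + a) + (1ℚ + y) * (a * a) - 1ℚ + κ)
          ≡⟨ cong (λ z → y * (a * a) + ((z * s + 1ℚ) * (a * a) + (σ + κ - 1ℚ)) - (z * (a + a) + (1ℚ + y) * (a * a) - 1ℚ + κ)) sσ≡1 ⟩
        y * (a * a) + ((1ℚ * s + 1ℚ) * (a * a) + (σ + κ - 1ℚ)) - (1ℚ * (a + a) + (1ℚ + y) * (a * a) - 1ℚ + κ)
          ≡⟨ tidy y a σ s κ ⟩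
        y * (a * a) + ((s + 1ℚ) * (a * a) + (σ + κ - 1ℚ)) - (a + a + (1ℚ + y) * (a * a) - 1ℚ + κ) ∎))
      where
      open ≡-Reasoning
      y = fromℕ i
      a = ι j
      expand : ∀ y a σ s κ → σ * ((1ℚ - s * a) * (1ℚ - s * a)) ≡
        y * (a * a) + (((s * σ) * s + 1ℚ) * (a * a) + (σ + κ - 1ℚ)) - ((s * σ) * (a + a) + (1ℚ + y) * (a * a) - 1ℚ + κ)
      expand = solve-∀ ℚ-ring
      tidy : ∀ y a σ s κ →
        y * (a * a) + ((1ℚ * s + 1ℚ) * (a * a) + (σ + κ - 1ℚ)) - (1ℚ * (a + a) + (1ℚ + y) * (a * a) - 1ℚ + κ)
        ≡ y * (a * a) + ((s + 1ℚ) * (a * a) + (σ + κ - 1ℚ)) - (a + a + (1ℚ + y) * (a * a) - 1ℚ + κ)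
      tidy = solve-∀ ℚ-ring

P̂≡⟨term⟩ : ∀ n → P̂ n ≡ ⟨ term ⟩ n
P̂≡⟨term⟩ n = trans (cong (_- conv α βH n) (begin
  conv αH β n + conv αH β n                                 ≡⟨ ∑↗-+ n _ _ ⟨
  ∑↗ n (λ j i → αH j * β i + αH j * β i)                    ≡⟨ ∑↗-cong n (λ j i _ → split (α j) (β i) (H j) (H i)) ⟩
  ∑↗ n (λ j i → α j * β i * term j i + α j * βH i)          ≡⟨ ∑↗-+ n _ _ ⟩
  ⟨ term ⟩ n + conv α βH n                                  ∎)) (cancel (⟨ term ⟩ n) (conv α βH n))
  where
  open ≡-Reasoning
  split : ∀ a b h g → a * h * b + a * h * b ≡ a * b * (h + h - g) + a * (b * g)
  split = solve-∀ ℚ-ring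
  cancel : ∀ x y → x + y - y ≡ x
  cancel = solve-∀ ℚ-ring

mean-deviation : ∀ n c (f : ℕ → ℕ → ℚ) → ⟨ (λ j i → f j i - c) ⟩ n ≡ ⟨ f ⟩ n - c * mass n
mean-deviation n c f = begin
  ⟨ (λ j i → f j i - c) ⟩ n               ≡⟨ cancel _ (c * mass n) ⟩
  ⟨ (λ j i → f j i - c) ⟩ n + c * mass n - c * mass n
    ≡⟨ cong (_- c * mass n) (trans (cong (λ z → ⟨ (λ j i → f j i - c) ⟩ n + z) (sym (∑↗-*ˡ n c _)))
         (trans (sym (∑↗-+ n _ _)) (∑↗-cong n λ j i _ → merge (α j * β i) (f j i) c))) ⟩
  ⟨ f ⟩ n - c * mass n                    ∎
  where
  open ≡-Reasoning
  cancel : ∀ x y → x ≡ x + y - y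
  cancel = solve-∀ ℚ-ring
  merge : ∀ w x c → w * (x - c) + c * w ≡ w * x
  merge = solve-∀ ℚ-ring

mean-deviation′ : ∀ n c (f : ℕ → ℕ → ℚ) → ⟨ (λ j i → c - f j i) ⟩ n ≡ c * mass n - ⟨ f ⟩ n
mean-deviation′ n c f = begin
  ⟨ (λ j i → c - f j i) ⟩ n               ≡⟨ cancel _ (⟨ f ⟩ n) ⟩
  ⟨ (λ j i → c - f j i) ⟩ n + ⟨ f ⟩ n - ⟨ f ⟩ n
    ≡⟨ cong (_- ⟨ f ⟩ n) (trans (sym (∑↗-+ n _ _))
         (trans (∑↗-cong n λ j i _ → merge (α j * β i) (f j i) c) (∑↗-*ˡ n c _))) ⟩
  c * mass n - ⟨ f ⟩ n                    ∎
  where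
  open ≡-Reasoning
  cancel : ∀ x y → x ≡ x + y - y
  cancel = solve-∀ ℚ-ring
  merge : ∀ w x c → w * (c - x) + w * x ≡ c * w
  merge = solve-∀ ℚ-ring

-- The choice n ≥ s² balances the two kinds of error, as then s/(n + 2) ≤ 1/s. In units of 1/s the
-- upper error is at most 4 + 5 + 1 and the lower one at most 1 + 6 + 1, so 10 serves both.
P̂-near : ∀ t n k → suc t ℕ.* suc t ℕ.≤ n → t ℕ.≤ k → ∀ x → x * mass n ≡ P̂ n →
         ∣ x - E k n ∣ ≤ fromℕ 10 * ι t
P̂-near t n k t²≤n t≤k x x≡ = ∣-∣-near {x} {E k n}
  (*-cancelʳ-≤-pos (mass n) {{positive (mass-pos n)}} (≤-same-difference
    (≤-trans (Mean≤.bound (mean-upper n k t)) (*-mass upper))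
    (trans (cong (λ z → fromℕ 10 * σ * mass n - z) (trans (mean-deviation n (E k n) term) (cong (_- E k n * mass n) ⟨term⟩≡)))
      (rearrange x (E k n) (fromℕ 10 * σ) (mass n)))))
  (*-cancelʳ-≤-pos (mass n) {{positive (mass-pos n)}} (≤-same-difference
    (≤-trans (Mean≤.bound (mean-lower n k t)) (*-mass lower))
    (trans (cong (λ z → fromℕ 10 * σ * mass n - z) (trans (mean-deviation′ n (E k n) term) (cong (λ z → E k n * mass n - z) ⟨term⟩≡)))
      (rearrange (E k n) x (fromℕ 10 * σ) (mass n)))))
  where
  σ = ι t
  κ = ι k
  s = 1ℚ + fromℕ t
  r = ι (suc n)
  ⟨term⟩≡ : ⟨ term ⟩ n ≡ x * mass n
  ⟨term⟩≡ = trans (sym (P̂≡⟨term⟩ n)) (sym x≡)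
  rearrange : ∀ x e d m → d * m - (x * m - e * m) ≡ (e + d) * m - x * m
  rearrange = solve-∀ ℚ-ring
  *-mass : ∀ {y z} → y ≤ z → y * mass n ≤ z * mass n
  *-mass y≤z = *-monoʳ-≤-nonNeg (mass n) {{nonNegative (<⇒≤ (mass-pos n))}} y≤z
  κ≤σ : κ ≤ σ
  κ≤σ = 1/-antimono t≤k
  sr≤σ : s * r ≤ σ
  sr≤σ = begin
    s * r                        ≤⟨ *-monoˡ (0≤+ (0≤fromℕ 1) (0≤fromℕ t)) (1/-antimono
                                      (ℕ.≤-trans (ℕ.n≤1+n _) (ℕ.≤-trans t²≤n (ℕ.n≤1+n n)))) ⟩
    s * ι (t ℕ.+ t ℕ.* suc t)    ≡⟨ cong (_* ι (t ℕ.+ t ℕ.* suc t)) (fromℕ-suc t) ⟨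
    fromℕ (suc t) * ι (t ℕ.+ t ℕ.* suc t)
                                 ≡⟨ n*1/[m*n]≡1/m t t _ refl ⟩
    σ                            ∎
    where open ≤-Reasoning
  r≤sr : r ≤ s * r
  r≤sr = ≤-from-difference (0≤* (0≤fromℕ t) (0≤ι (suc n))) (difference (fromℕ t) r)
    where
    difference : ∀ t r → t * r ≡ (1ℚ + t) * r - r
    difference = solve-∀ ℚ-ring
  0≤σ-sr = 0≤-difference sr≤σ
  0≤σ-κ = 0≤-difference κ≤σ
  upper : fromℕ 4 * σ + fromℕ 5 * (s * r) + κ ≤ fromℕ 10 * σ
  upper = ≤-from-difference (0≤+ (0≤* (0≤fromℕ 5) 0≤σ-sr) 0≤σ-κ) (difference σ κ (s * r))
    where
    difference : ∀ σ κ z → fromℕ 5 * (σ - z) + (σ - κ) ≡ fromℕ 10 * σ - (fromℕ 4 * σ + fromℕ 5 * z + κ)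
    difference = solve-∀ ℚ-ring
  lower : σ + fromℕ 3 * ((s + 1ℚ) * r) + κ ≤ fromℕ 10 * σ
  lower = ≤-from-difference
    (0≤+ (0≤+ (0≤* (0≤fromℕ 6) 0≤σ-sr) 0≤σ-κ) (0≤+ (0≤* (0≤fromℕ 3) (0≤-difference r≤sr)) (0≤* (0≤fromℕ 2) (0≤ι t))))
    (difference σ κ s r)
    where
    difference : ∀ σ κ s r → fromℕ 6 * (σ - s * r) + (σ - κ) + (fromℕ 3 * (s * r - r) + fromℕ 2 * σ)
                 ≡ fromℕ 10 * σ - (σ + fromℕ 3 * ((s + 1ℚ) * r) + κ)
    difference = solve-∀ ℚ-ring

p/q⟶γ : (x : ℕ → ℚ) → (∀ m → x m * fromℕ (q (4 ℕ.+ m)) ≡ p (4 ℕ.+ m)) → (λ m → fromℚ (x m)) ⟶ γ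
p/q⟶γ x x*q≡p ε 0<ε = N , λ m N≤m δ 0<δ →
  let n = 4 ℕ.+ m
      N≤n = ℕ.≤-trans N≤m (ℕ.m≤n+m m 4)
      K , near = proj₂ limit n (ℕ.m+n≤o⇒n≤o (suc t ℕ.* suc t) N≤n) δ 0<δ
  in t ℕ.+ K , λ k ≤k → begin
    ∣ x m - approx γ k ∣
      ≤⟨ ∣-∣-triangle (x m) (E k n) (approx γ k) ⟩
    ∣ x m - E k n ∣ + ∣ E k n - approx γ k ∣
      ≤⟨ +-mono-≤ (P̂-near t n k (ℕ.m+n≤o⇒m≤o (suc t ℕ.* suc t) N≤n) (ℕ.m+n≤o⇒m≤o t ≤k) (x m) (x*mass m))
                  (near k (ℕ.m+n≤o⇒n≤o t ≤k)) ⟩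
    fromℕ 10 * ι t + (half ε + δ)
      ≤⟨ +-monoˡ-≤ (half ε + δ) (≤-trans (*-monoˡ (0≤fromℕ 10) (proj₂ small t ℕ.≤-refl)) (≤-reflexive (scale-back (half ε)))) ⟩
    half ε + (half ε + δ)
      ≡⟨ trans (sym (+-assoc (half ε) (half ε) δ)) (cong (_+ δ) (half+half ε)) ⟩
    ε + δ ∎
  where
  open ≤-Reasoning
  -- `ι 9` is 1/10 and undoes the factor 10 of `P̂-near`; the other half of `ε` is for the
  -- convergence of H - log to γ.
  small = archimedean (ι 9 * half ε) (positive⁻¹ _ {{pos*pos⇒pos (ι 9) (half ε) {{positive (half-pos 0<ε)}}}})
  t = proj₁ small
  limit = H-log-⟶-γ (half ε) (half-pos 0<ε)
  N = suc t ℕ.* suc t ℕ.+ proj₁ limit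
  scale-back : ∀ y → fromℕ 10 * (ι 9 * y) ≡ y
  scale-back = solve-∀ ℚ-ring
  x*mass : ∀ m → x m * mass (4 ℕ.+ m) ≡ P̂ (4 ℕ.+ m)
  x*mass m = *-cancelˡ-≡-pos (F * F) {{pos*pos⇒pos F {{F-pos}} F {{F-pos}}}}
    (trans (swap F (x m) (mass (4 ℕ.+ m))) (trans (cong (x m *_) (sym (q≡ (4 ℕ.+ m)))) (x*q≡p m)))
    where
    F = (4 ℕ.+ m) !ℚ
    F-pos : Positive F
    F-pos = fromℕ-pos ((4 ℕ.+ m) !) {{ℕ._!≢0 (4 ℕ.+ m)}}
    swap : ∀ f x y → f * f * (x * y) ≡ x * (f * f * y)
    swap = solve-∀ ℚ-ring

÷-*-cancel : ∀ x y .{{_ : NonZero y}} → (x ÷ y) * y ≡ x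
÷-*-cancel x y = trans (*-assoc x (1/ y) y) (trans (cong (x *_) (*-inverseˡ y)) (*-identityʳ x))

theorem3 : (Δ : ℕ → ℚ) →
    Δ 1 ≡ fromℤ (-ℤ + 1) →
    Δ 2 ≡ fromℤ (-ℤ + 2) →
    Δ 3 ≡ fromℤ (-ℤ + 5) →
    Δ 4 ≡ fromℤ (+ 8) →
    (∀ n → 3 ≤ℕ n →
    (fromℕ n - fromℕ 1) * (fromℕ n - fromℕ 2) * Δ (n +ℕ 2)
    ≡ (fromℕ n - fromℕ 2) * (fromℕ n + fromℕ 1) * (fromℕ (n ^ 2) + fromℕ (3 *ℕ n) - fromℕ 2) * Δ (n +ℕ 1)
    - fromℕ (n ^ 2) * (fromℕ (2 *ℕ n ^ 3) + fromℕ (n ^ 2) - fromℕ (7 *ℕ n) - fromℕ 4) * Δ n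
    + fromℕ ((n ∸ℕ 1) ^ 2 *ℕ n ^ 4) * Δ (n ∸ℕ 1)) →
    (∀ n → 1 ≤ℕ n → IsInteger (Δ n))
    × γ ≡K[ a* Δ / b* Δ ]
    × (∀ n → 4 ≤ℕ n → 0ℚ < Δ n)
    × (∀ n → 1 ≤ℕ n → IsEvenInteger (Δ (2 *ℕ n)))
theorem3 Δ Δ1 Δ2 Δ3 Δ4 rec =
  Δ-integer , expansion , (λ n 4≤n → positive⁻¹ (Δ n) {{Δ-positive n 4≤n}}) , Δ-even
  where
  open Recurrence Δ Δ1 Δ2 Δ3 Δ4 rec

  denominator-pos : ∀ n → 4 ℕ.≤ n → Positive (denominator (a* Δ) (b* Δ) n)
  denominator-pos n 4≤n = subst (λ n → Positive (denominator (a* Δ) (b* Δ) n)) (ℕ.m+[n∸m]≡n 4≤n)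
    (subst Positive (sym (denominator≡ m)) (pos*pos⇒pos (scale m) {{scale-pos m}} (fromℕ (q (4 ℕ.+ m))) {{fromℕ-pos (q (4 ℕ.+ m)) {{ℕ.>-nonZero (q-pos (4 ℕ.+ m))}}}}))
    where m = n ℕ.∸ 4

  nonvanishing : ∀ n → 4 ℕ.≤ n → denominator (a* Δ) (b* Δ) n ≢ 0ℚ
  nonvanishing n 4≤n eq = <-irrefl (sym eq) (positive⁻¹ _ {{denominator-pos n 4≤n}})

  -- This is what `convergent` unfolds to for `start = 4`, so the limit statement for it is
  -- literally the field `converges`.
  quotient : ℕ → ℚ
  quotient m = (numerator (a* Δ) (b* Δ) (4 ℕ.+ m) ÷ denominator (a* Δ) (b* Δ) (4 ℕ.+ m))
    {{≢-nonZero (nonvanishing (4 ℕ.+ m) (ℕ.m≤m+n 4 m))}}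

  quotient*q≡p : ∀ m → quotient m * fromℕ (q (4 ℕ.+ m)) ≡ p (4 ℕ.+ m)
  quotient*q≡p m = *-cancelˡ-≡-pos (scale m) {{scale-pos m}} (begin
    scale m * (quotient m * fromℕ (q (4 ℕ.+ m)))          ≡⟨ swap (scale m) (quotient m) _ ⟩
    quotient m * (scale m * fromℕ (q (4 ℕ.+ m)))          ≡⟨ cong (quotient m *_) (denominator≡ m) ⟨
    quotient m * denominator (a* Δ) (b* Δ) (4 ℕ.+ m)      ≡⟨ ÷-*-cancel _ _ {{≢-nonZero (nonvanishing (4 ℕ.+ m) (ℕ.m≤m+n 4 m))}} ⟩
    numerator (a* Δ) (b* Δ) (4 ℕ.+ m)                     ≡⟨ numerator≡ m ⟩
    scale m * p (4 ℕ.+ m)                                 ∎)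
    where
    open ≡-Reasoning
    swap : ∀ s x y → s * (x * y) ≡ x * (s * y)
    swap = solve-∀ ℚ-ring

  expansion : γ ≡K[ a* Δ / b* Δ ]
  expansion = record
    { start        = 4
    ; nonvanishing = nonvanishing
    ; converges    = p/q⟶γ quotient quotient*q≡p
    }
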